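{- Let $a$ be an integer. The (homogeneous) Jacobi--Perron expansion of the vector $(1,|\tau|,\tau^2)$ is periodic whenever (1) $\tau$ is a root of the polynomial $x^3+(a-1)x^2-ax-1$ where $a\geq 3$, or (2) $\tau$ is a root of the polynomial $x^3-(a-1)x^2-ax-1$ where $a\geq 5$.
   Context: All roots of these polynomials are real. The (homogeneous) Jacobi--Perron expansion (JPA expansion) of a vector $\boldsymbol{\beta}^{(0)}=(\beta_1^{(0)},\beta_2^{(0)},\beta_3^{(0)})\in\mathbb{R}^3$ is the sequence of vectors $\boldsymbol{\beta}^{(k)}$, $k\ge 0$, defined by $$\boldsymbol{\beta}^{(k+1)}=\left(\beta_2^{(k)}-b_2^{(k)}\beta_1^{(k)},\ \beta_3^{(k)}-b_3^{(k)}\beta_1^{(k)},\ \beta_1^{(k)}\right),\qquad b_i^{(k)}=\left\lfloor \beta_i^{(k)}/\beta_1^{(k)}\right\rfloor .$$ The expansion is called periodic if there exist integers $l_0\ge 0$, $l_1\ge 1$ and a unit $\varepsilon$ (of the ring of integers of $\mathbb{Q}(\tau)$) such that $\beta_i^{(k+l_1)}=\varepsilon\beta_i^{(k)}$ for all $1\le i\le 3$ and all $k\ge l_0$. -}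

module Defs where

open import Algebra.Bundles using (CommutativeMonoid; CommutativeRing)
import Algebra.Properties.CommutativeSemigroup as CommutativeSemigroupProperties
import Algebra.Properties.Group as GroupProperties
import Algebra.Properties.Ring as RingProperties
open import Data.Empty using (⊥-elim)
open import Data.Fin.Patterns using (0F; 1F; 2F)
open import Data.Integer as ℤ using (ℤ; 1ℤ)
open import Data.List using (List; []; _∷_; _++_; [_])
open import Data.Nat as ℕ using (ℕ; suc; _⊔_)
import Data.Nat.Properties as ℕ
open import Data.Product using (Σ; ∃; ∃-syntax; _×_; _,_)
open import Data.Rational as ℚ using (ℚ; 0ℚ; 1ℚ; ½; ∣_∣)
open import Data.Sum using (_⊎_; inj₁; inj₂)
open import Data.Vec.Functional using (Vector)
open import Relation.Binary.PropositionalEquality using (_≡_; _≢_; refl; sym; trans; cong; cong₂; subst)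
open import Relation.Nullary using (¬_; yes; no)

-- Stated for an arbitrary ring because ℚ's operations unfold on variables,
-- which makes the ring solver for ℚ impractically slow.
module Identities {c ℓ} (R : CommutativeRing c ℓ) where
  open CommutativeRing R renaming (Carrier to A; refl to ≈-refl; sym to ≈-sym; trans to ≈-trans)
    hiding (_-_)
  open import Relation.Binary.Reasoning.Setoid setoid
  open GroupProperties +-group public
    using () renaming ( //-rightDividesˡ to x-y+y; //-rightDividesʳ to x+y-y
                      ; ⁻¹-anti-homo-// to neg-swap; ⁻¹-involutive to neg-involutive
                      ; \\-leftDividesʳ to -x+[x+y] )
  open RingProperties ring using (-‿+-comm; x[y-z]≈xy-xz)
  open CommutativeSemigroupProperties (CommutativeMonoid.commutativeSemigroup +-commutativeMonoid)
    using () renaming (interchange to +-interchange)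
  open CommutativeSemigroupProperties *-commutativeSemigroup public
    using (x∙yz≈yx∙z; x∙yz≈xz∙y; x∙yz≈zx∙y)

  infixl 6 _-_
  _-_ : A → A → A
  x - y = x + - y

  [x+y]-[z+w] : ∀ x y z w → (x + y) - (z + w) ≈ (x - z) + (y - w)
  [x+y]-[z+w] x y z w = begin
    (x + y) + - (z + w)    ≈⟨ +-congˡ (-‿+-comm z w) ⟨
    (x + y) + (- z + - w)  ≈⟨ +-interchange x y (- z) (- w) ⟩
    (x - z) + (y - w)      ∎

  xy-zw : ∀ x y z w → x * y - z * w ≈ x * (y - w) + w * (x - z)
  xy-zw x y z w = ≈-sym (begin
    x * (y - w) + w * (x - z)            ≈⟨ +-cong (x[y-z]≈xy-xz x y w) (x[y-z]≈xy-xz w x z) ⟩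
    (x * y - x * w) + (w * x - w * z)    ≈⟨ +-congˡ (+-cong (*-comm w x) (-‿cong (*-comm w z))) ⟩
    (x * y - x * w) + (x * w - z * w)    ≈⟨ +-assoc (x * y - x * w) (x * w) (- (z * w)) ⟨
    ((x * y - x * w) + x * w) - z * w    ≈⟨ +-congʳ (x-y+y (x * w) (x * y)) ⟩
    x * y - z * w                        ∎)

  u[qv]-v[pu] : ∀ u v p q → u * (q * v) - v * (p * u) ≈ (u * v) * (q - p)
  u[qv]-v[pu] u v p q = begin
    u * (q * v) - v * (p * u)      ≈⟨ +-cong (x∙yz≈xz∙y u q v) (-‿cong (x∙yz≈zx∙y v p u)) ⟩
    (u * v) * q - (u * v) * p      ≈⟨ x[y-z]≈xy-xz (u * v) q p ⟨
    (u * v) * (q - p)              ∎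

open import Data.Rational.Properties as ℚ
open module ℚ-Identities = Identities +-*-commutativeRing using
  ( x-y+y; x+y-y; neg-swap; neg-involutive; -x+[x+y]; x∙yz≈yx∙z; [x+y]-[z+w]; xy-zw; u[qv]-v[pu])

½+½ : ∀ ε → ½ ℚ.* ε ℚ.+ ½ ℚ.* ε ≡ ε
½+½ ε = trans (sym (*-distribʳ-+ ε ½ ½)) (*-identityˡ ε)

*-pos : ∀ {p q} → 0ℚ ℚ.< p → 0ℚ ℚ.< q → 0ℚ ℚ.< p ℚ.* q
*-pos {p} {q} 0<p 0<q =
  subst (ℚ._< p ℚ.* q) (*-zeroʳ p)
    (*-monoʳ-<-pos p {{ℚ.positive 0<p}} 0<q)

half-pos : ∀ {ε} → 0ℚ ℚ.< ε → 0ℚ ℚ.< ½ ℚ.* ε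
half-pos = *-pos (positive⁻¹ ½)

p-q+q : ∀ p q → p ≡ (p ℚ.- q) ℚ.+ q
p-q+q p q = sym (x-y+y q p)

∣p-q∣≡∣q-p∣ : ∀ p q → ∣ p ℚ.- q ∣ ≡ ∣ q ℚ.- p ∣
∣p-q∣≡∣q-p∣ p q =
  trans (cong ∣_∣ (sym (neg-swap q p))) (∣-p∣≡∣p∣ (q ℚ.- p))

p≤∣p∣ : ∀ p → p ℚ.≤ ∣ p ∣
p≤∣p∣ p with ≤-total 0ℚ p
... | inj₁ 0≤p = ≤-reflexive (sym (0≤p⇒∣p∣≡p 0≤p))
... | inj₂ p≤0 = ≤-trans p≤0 (0≤∣p∣ p)

∣∣-triangle : ∀ p q → ∣ p ∣ ℚ.≤ ∣ p ℚ.- q ∣ ℚ.+ ∣ q ∣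
∣∣-triangle p q =
  ≤-trans (≤-reflexive (cong ∣_∣ (p-q+q p q))) (∣p+q∣≤∣p∣+∣q∣ (p ℚ.- q) q)

cancel : ∀ {p q r} → p ℚ.≤ q ℚ.+ r → p ℚ.- r ℚ.≤ q
cancel {p} {q} {r} h =
  ≤-trans (+-monoˡ-≤ (ℚ.- r) h)
          (≤-reflexive (x+y-y r q))

∣∣-lipschitz : ∀ p q → ∣ ∣ p ∣ ℚ.- ∣ q ∣ ∣ ℚ.≤ ∣ p ℚ.- q ∣
∣∣-lipschitz p q with ∣p∣≡p∨∣p∣≡-p (∣ p ∣ ℚ.- ∣ q ∣)
... | inj₁ eq = ≤-trans (≤-reflexive eq) (cancel (∣∣-triangle p q))
... | inj₂ eq = ≤-trans
  (≤-reflexive (trans eq (neg-swap ∣ p ∣ ∣ q ∣)))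
  (cancel (≤-trans (∣∣-triangle q p)
    (≤-reflexive (cong (ℚ._+ ∣ p ∣) (∣p-q∣≡∣q-p∣ q p)))))

*-mono-≤-nonNeg : ∀ {p q r s} → 0ℚ ℚ.≤ q → 0ℚ ℚ.≤ r →
                  p ℚ.≤ q → r ℚ.≤ s → p ℚ.* r ℚ.≤ q ℚ.* s
*-mono-≤-nonNeg {p} {q} {r} {s} 0≤q 0≤r p≤q r≤s =
  ≤-trans (*-monoʳ-≤-nonNeg r {{ℚ.nonNegative 0≤r}} p≤q)
          (*-monoˡ-≤-nonNeg q {{ℚ.nonNegative 0≤q}} r≤s)

recip-pos : ∀ {p} → 0ℚ ℚ.< p → ∃[ q ] (0ℚ ℚ.< q × p ℚ.* q ≡ 1ℚ)
recip-pos {p} 0<p = q , positive⁻¹ q {{1/pos⇒pos p {{p⁺}}}} , *-inverseʳ p {{p≢0}}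
  where
  p⁺ = ℚ.positive {p} 0<p
  p≢0 = pos⇒nonZero p {{p⁺}}
  q = (ℚ.1/ p) {{p≢0}}

-- Totalised so that inv can act termwise; if x # 0 only finitely many terms of x are 0.
recip : ℚ → ℚ
recip p with p ℚ.≟ 0ℚ
... | yes _   = 0ℚ
... | no  p≢0 = (ℚ.1/ p) {{ℚ.≢-nonZero p≢0}}

recip-inverse : ∀ p → p ≢ 0ℚ → p ℚ.* recip p ≡ 1ℚ
recip-inverse p p≢0′ with p ℚ.≟ 0ℚ
... | yes p≡0 = ⊥-elim (p≢0′ p≡0)
... | no  p≢0 = *-inverseʳ p {{ℚ.≢-nonZero {p} p≢0}}

module _ {δ D : ℚ} (0<δ : 0ℚ ℚ.< δ) (0<D : 0ℚ ℚ.< D) (δD : δ ℚ.* D ≡ 1ℚ) where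

  δ<∣p∣⇒p≢0 : ∀ p → δ ℚ.< ∣ p ∣ → p ≢ 0ℚ
  δ<∣p∣⇒p≢0 p δ<p refl = <-irrefl refl (<-trans 0<δ δ<p)

  ∣recip∣≤ : ∀ p → δ ℚ.< ∣ p ∣ → ∣ recip p ∣ ℚ.≤ D
  ∣recip∣≤ p δ<p = begin
    ∣ u ∣                    ≡⟨ *-identityʳ _ ⟨
    ∣ u ∣ ℚ.* 1ℚ             ≡⟨ cong (∣ u ∣ ℚ.*_) δD ⟨
    ∣ u ∣ ℚ.* (δ ℚ.* D)      ≤⟨ *-monoˡ-≤-nonNeg ∣ u ∣ {{ℚ.nonNegative (0≤∣p∣ u)}}
                                 (*-monoʳ-≤-nonNeg D {{ℚ.nonNegative (<⇒≤ 0<D)}} (<⇒≤ δ<p)) ⟩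
    ∣ u ∣ ℚ.* (∣ p ∣ ℚ.* D)  ≡⟨ x∙yz≈yx∙z ∣ u ∣ ∣ p ∣ D ⟩
    (∣ p ∣ ℚ.* ∣ u ∣) ℚ.* D  ≡⟨ cong (ℚ._* D) (∣p*q∣≡∣p∣*∣q∣ p u) ⟨
    ∣ p ℚ.* u ∣ ℚ.* D        ≡⟨ cong (λ q → ∣ q ∣ ℚ.* D) (recip-inverse p (δ<∣p∣⇒p≢0 p δ<p)) ⟩
    1ℚ ℚ.* D                 ≡⟨ *-identityˡ D ⟩
    D                        ∎
    where
    open ≤-Reasoning
    u = recip p

  recip-diff : ∀ p q → δ ℚ.< ∣ p ∣ → δ ℚ.< ∣ q ∣ →
               ∣ recip p ℚ.- recip q ∣ ℚ.≤ (D ℚ.* D) ℚ.* ∣ p ℚ.- q ∣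
  recip-diff p q δ<p δ<q = begin
    ∣ u ℚ.- v ∣                            ≡⟨ cong ∣_∣ u-v ⟩
    ∣ (u ℚ.* v) ℚ.* (q ℚ.- p) ∣            ≡⟨ ∣p*q∣≡∣p∣*∣q∣ (u ℚ.* v) (q ℚ.- p) ⟩
    ∣ u ℚ.* v ∣ ℚ.* ∣ q ℚ.- p ∣            ≡⟨ cong₂ ℚ._*_ (∣p*q∣≡∣p∣*∣q∣ u v) (∣p-q∣≡∣q-p∣ q p) ⟩
    (∣ u ∣ ℚ.* ∣ v ∣) ℚ.* ∣ p ℚ.- q ∣      ≤⟨ *-monoʳ-≤-nonNeg ∣ p ℚ.- q ∣ {{ℚ.nonNegative (0≤∣p∣ (p ℚ.- q))}}
                                               (*-mono-≤-nonNeg (<⇒≤ 0<D) (0≤∣p∣ v)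
                                                 (∣recip∣≤ p δ<p) (∣recip∣≤ q δ<q)) ⟩
    (D ℚ.* D) ℚ.* ∣ p ℚ.- q ∣              ∎
    where
    open ≤-Reasoning
    u = recip p
    v = recip q
    u-v : u ℚ.- v ≡ (u ℚ.* v) ℚ.* (q ℚ.- p)
    u-v = trans
      (cong₂ ℚ._-_
        (trans (sym (*-identityʳ u)) (cong (u ℚ.*_) (sym (recip-inverse q (δ<∣p∣⇒p≢0 q δ<q)))))
        (trans (sym (*-identityʳ v)) (cong (v ℚ.*_) (sym (recip-inverse p (δ<∣p∣⇒p≢0 p δ<p))))))
      (u[qv]-v[pu] u v p q)

Cauchy : (ℕ → ℚ) → Set
Cauchy s = ∀ ε → 0ℚ ℚ.< ε →
  ∃[ N ] ∀ m n → N ℕ.≤ m → N ℕ.≤ n → ∣ s m ℚ.- s n ∣ ℚ.< ε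

-- Real numbers are Cauchy sequences of rationals; _≈_ is their equality.
record ℝ : Set where
  constructor mkℝ
  field
    seq    : ℕ → ℚ
    cauchy : Cauchy seq

open ℝ public

infix  4 _≈_ _<_ _≤_ _#_
infixl 6 _+_ _-_
infixl 7 _*_ _/_[_]
infix  8 -_

_≈_ : ℝ → ℝ → Set
x ≈ y = ∀ ε → 0ℚ ℚ.< ε → ∃[ N ] ∀ n → N ℕ.≤ n → ∣ seq x n ℚ.- seq y n ∣ ℚ.< ε

_<_ : ℝ → ℝ → Set
x < y = ∃[ ε ] (0ℚ ℚ.< ε × ∃[ N ] ∀ n → N ℕ.≤ n → seq x n ℚ.+ ε ℚ.< seq y n)

_≤_ : ℝ → ℝ → Set
x ≤ y = ¬ (y < x)

-- Apartness, the constructive form of x ≠ y.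
_#_ : ℝ → ℝ → Set
x # y = x < y ⊎ y < x

fromℚ : ℚ → ℝ
fromℚ q = mkℝ (λ _ → q) λ ε 0<ε → 0 , λ _ _ _ _ →
  subst (ℚ._< ε) (cong ∣_∣ (sym (+-inverseʳ q))) 0<ε

fromℤ : ℤ → ℝ
fromℤ i = fromℚ (i ℚ./ 1)

0ℝ 1ℝ : ℝ
0ℝ = fromℚ 0ℚ
1ℝ = fromℚ 1ℚ

_+_ : ℝ → ℝ → ℝ
x + y = mkℝ (λ n → seq x n ℚ.+ seq y n) sum-cauchy
  where
  sum-cauchy : Cauchy (λ n → seq x n ℚ.+ seq y n)
  sum-cauchy ε 0<ε with cauchy x (½ ℚ.* ε) (half-pos 0<ε) | cauchy y (½ ℚ.* ε) (half-pos 0<ε)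
  ... | M , hx | N , hy = M ⊔ N , λ m n m≥ n≥ → begin-strict
      ∣ (seq x m ℚ.+ seq y m) ℚ.- (seq x n ℚ.+ seq y n) ∣
        ≡⟨ cong ∣_∣ ([x+y]-[z+w] (seq x m) (seq y m) (seq x n) (seq y n)) ⟩
      ∣ (seq x m ℚ.- seq x n) ℚ.+ (seq y m ℚ.- seq y n) ∣
        ≤⟨ ∣p+q∣≤∣p∣+∣q∣ (seq x m ℚ.- seq x n) (seq y m ℚ.- seq y n) ⟩
      ∣ seq x m ℚ.- seq x n ∣ ℚ.+ ∣ seq y m ℚ.- seq y n ∣
        <⟨ +-mono-< (hx m n (ℕ.m⊔n≤o⇒m≤o M N m≥) (ℕ.m⊔n≤o⇒m≤o M N n≥))
                    (hy m n (ℕ.m⊔n≤o⇒n≤o M N m≥) (ℕ.m⊔n≤o⇒n≤o M N n≥)) ⟩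
      ½ ℚ.* ε ℚ.+ ½ ℚ.* ε
        ≡⟨ ½+½ ε ⟩
      ε ∎
    where open ≤-Reasoning

-_ : ℝ → ℝ
- x = mkℝ (λ n → ℚ.- seq x n) λ ε 0<ε → let N , h = cauchy x ε 0<ε in
  N , λ m n m≥ n≥ → subst (ℚ._< ε) (eq m n) (h m n m≥ n≥)
  where
  eq : ∀ m n → ∣ seq x m ℚ.- seq x n ∣ ≡ ∣ ℚ.- seq x m ℚ.- ℚ.- seq x n ∣
  eq m n = trans (∣p-q∣≡∣q-p∣ (seq x m) (seq x n))
    (cong ∣_∣ (trans (+-comm (seq x n) (ℚ.- seq x m))
                     (cong (ℚ.- seq x m ℚ.+_) (sym (neg-involutive (seq x n))))))

_-_ : ℝ → ℝ → ℝ
x - y = x + - y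

abs : ℝ → ℝ
abs x = mkℝ (λ n → ∣ seq x n ∣) λ ε 0<ε → let N , h = cauchy x ε 0<ε in
  N , λ m n m≥ n≥ → ≤-<-trans (∣∣-lipschitz (seq x m) (seq x n)) (h m n m≥ n≥)

bounded : ∀ x → ∃[ B ] (0ℚ ℚ.< B × ∃[ N ] ∀ n → N ℕ.≤ n → ∣ seq x n ∣ ℚ.≤ B)
bounded x with cauchy x 1ℚ (positive⁻¹ 1ℚ)
... | N , h = 1ℚ ℚ.+ ∣ seq x N ∣
            , +-mono-<-≤ (positive⁻¹ 1ℚ) (0≤∣p∣ (seq x N))
            , N , λ n n≥ → ≤-trans (∣∣-triangle (seq x n) (seq x N))
                    (+-monoˡ-≤ ∣ seq x N ∣ (<⇒≤ (h n N n≥ ℕ.≤-refl)))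

scale : ∀ B C ε → B ℚ.* C ≡ 1ℚ → B ℚ.* (C ℚ.* ε) ≡ ε
scale B C ε BC =
  trans (sym (*-assoc B C ε)) (trans (cong (ℚ._* ε) BC) (*-identityˡ ε))

_*_ : ℝ → ℝ → ℝ
x * y = mkℝ (λ n → seq x n ℚ.* seq y n) prod-cauchy
  where
  prod-cauchy : Cauchy (λ n → seq x n ℚ.* seq y n)
  prod-cauchy ε 0<ε
    with B , 0<B , K , bx ← bounded x | C , 0<C , L , by ← bounded y
    with B′ , 0<B′ , BB′ ← recip-pos 0<B | C′ , 0<C′ , CC′ ← recip-pos 0<C
    with M , hx ← cauchy x (C′ ℚ.* (½ ℚ.* ε)) (*-pos 0<C′ (half-pos 0<ε))
       | N , hy ← cauchy y (B′ ℚ.* (½ ℚ.* ε)) (*-pos 0<B′ (half-pos 0<ε))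
    = (K ⊔ L) ⊔ (M ⊔ N) , λ m n m≥ n≥ →
      let m≥KL = ℕ.m⊔n≤o⇒m≤o (K ⊔ L) (M ⊔ N) m≥
          m≥MN = ℕ.m⊔n≤o⇒n≤o (K ⊔ L) (M ⊔ N) m≥
          n≥KL = ℕ.m⊔n≤o⇒m≤o (K ⊔ L) (M ⊔ N) n≥
          n≥MN = ℕ.m⊔n≤o⇒n≤o (K ⊔ L) (M ⊔ N) n≥
          xm = seq x m ; xn = seq x n ; ym = seq y m ; yn = seq y n
      in begin-strict
      ∣ xm ℚ.* ym ℚ.- xn ℚ.* yn ∣
        ≡⟨ cong ∣_∣ (xy-zw xm ym xn yn) ⟩
      ∣ xm ℚ.* (ym ℚ.- yn) ℚ.+ yn ℚ.* (xm ℚ.- xn) ∣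
        ≤⟨ ∣p+q∣≤∣p∣+∣q∣ (xm ℚ.* (ym ℚ.- yn)) (yn ℚ.* (xm ℚ.- xn)) ⟩
      ∣ xm ℚ.* (ym ℚ.- yn) ∣ ℚ.+ ∣ yn ℚ.* (xm ℚ.- xn) ∣
        ≡⟨ cong₂ ℚ._+_ (∣p*q∣≡∣p∣*∣q∣ xm (ym ℚ.- yn)) (∣p*q∣≡∣p∣*∣q∣ yn (xm ℚ.- xn)) ⟩
      ∣ xm ∣ ℚ.* ∣ ym ℚ.- yn ∣ ℚ.+ ∣ yn ∣ ℚ.* ∣ xm ℚ.- xn ∣
        ≤⟨ +-mono-≤
             (*-monoʳ-≤-nonNeg ∣ ym ℚ.- yn ∣ {{ℚ.nonNegative (0≤∣p∣ (ym ℚ.- yn))}}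
               (bx m (ℕ.m⊔n≤o⇒m≤o K L m≥KL)))
             (*-monoʳ-≤-nonNeg ∣ xm ℚ.- xn ∣ {{ℚ.nonNegative (0≤∣p∣ (xm ℚ.- xn))}}
               (by n (ℕ.m⊔n≤o⇒n≤o K L n≥KL))) ⟩
      B ℚ.* ∣ ym ℚ.- yn ∣ ℚ.+ C ℚ.* ∣ xm ℚ.- xn ∣
        <⟨ +-mono-<
             (*-monoʳ-<-pos B {{ℚ.positive 0<B}}
               (hy m n (ℕ.m⊔n≤o⇒n≤o M N m≥MN) (ℕ.m⊔n≤o⇒n≤o M N n≥MN)))
             (*-monoʳ-<-pos C {{ℚ.positive 0<C}}
               (hx m n (ℕ.m⊔n≤o⇒m≤o M N m≥MN) (ℕ.m⊔n≤o⇒m≤o M N n≥MN))) ⟩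
      B ℚ.* (B′ ℚ.* (½ ℚ.* ε)) ℚ.+ C ℚ.* (C′ ℚ.* (½ ℚ.* ε))
        ≡⟨ cong₂ ℚ._+_ (scale B B′ (½ ℚ.* ε) BB′) (scale C C′ (½ ℚ.* ε) CC′) ⟩
      ½ ℚ.* ε ℚ.+ ½ ℚ.* ε
        ≡⟨ ½+½ ε ⟩
      ε ∎
    where open ≤-Reasoning

bounded-away : ∀ x → x # 0ℝ →
  ∃[ δ ] (0ℚ ℚ.< δ × ∃[ N ] ∀ n → N ℕ.≤ n → δ ℚ.< ∣ seq x n ∣)
bounded-away x (inj₁ (δ , 0<δ , N , h)) = δ , 0<δ , N , λ n n≥ → begin-strict
    δ                              ≡⟨ -x+[x+y] (seq x n) δ ⟨
    ℚ.- seq x n ℚ.+ (seq x n ℚ.+ δ) <⟨ +-monoʳ-< (ℚ.- seq x n) (h n n≥) ⟩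
    ℚ.- seq x n ℚ.+ 0ℚ             ≡⟨ +-identityʳ _ ⟩
    ℚ.- seq x n                    ≤⟨ p≤∣p∣ _ ⟩
    ∣ ℚ.- seq x n ∣                ≡⟨ ∣-p∣≡∣p∣ (seq x n) ⟩
    ∣ seq x n ∣                    ∎
  where open ≤-Reasoning
bounded-away x (inj₂ (δ , 0<δ , N , h)) = δ , 0<δ , N , λ n n≥ →
  <-≤-trans (subst (ℚ._< seq x n) (+-identityˡ δ) (h n n≥)) (p≤∣p∣ (seq x n))

inv : (x : ℝ) → x # 0ℝ → ℝ
inv x x#0 = mkℝ (λ n → recip (seq x n)) inv-cauchy
  where
  inv-cauchy : Cauchy (λ n → recip (seq x n))
  inv-cauchy ε 0<ε
    with δ , 0<δ , K , away ← bounded-away x x#0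
    with D , 0<D , δD ← recip-pos 0<δ
    with Dδ ← trans (*-comm D δ) δD
    with N , h ← cauchy x (δ ℚ.* (δ ℚ.* ε)) (*-pos 0<δ (*-pos 0<δ 0<ε))
    = K ⊔ N , λ m n m≥ n≥ → begin-strict
      ∣ recip (seq x m) ℚ.- recip (seq x n) ∣
        ≤⟨ recip-diff 0<δ 0<D δD (seq x m) (seq x n)
             (away m (ℕ.m⊔n≤o⇒m≤o K N m≥)) (away n (ℕ.m⊔n≤o⇒m≤o K N n≥)) ⟩
      (D ℚ.* D) ℚ.* ∣ seq x m ℚ.- seq x n ∣
        <⟨ *-monoʳ-<-pos (D ℚ.* D) {{ℚ.positive (*-pos 0<D 0<D)}}
             (h m n (ℕ.m⊔n≤o⇒n≤o K N m≥) (ℕ.m⊔n≤o⇒n≤o K N n≥)) ⟩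
      (D ℚ.* D) ℚ.* (δ ℚ.* (δ ℚ.* ε))
        ≡⟨ *-assoc D D (δ ℚ.* (δ ℚ.* ε)) ⟩
      D ℚ.* (D ℚ.* (δ ℚ.* (δ ℚ.* ε)))
        ≡⟨ cong (D ℚ.*_) (scale D δ (δ ℚ.* ε) Dδ) ⟩
      D ℚ.* (δ ℚ.* ε)
        ≡⟨ scale D δ ε Dδ ⟩
      ε ∎
    where open ≤-Reasoning

_/_[_] : (x y : ℝ) → y # 0ℝ → ℝ
x / y [ y#0 ] = x * inv y y#0

IsFloor : ℝ → ℤ → Set
IsFloor x b = fromℤ b ≤ x × x < fromℤ (b ℤ.+ 1ℤ)

-- Horner evaluation; coefficients are listed from the constant term upwards.
eval : List ℤ → ℝ → ℝ
eval []       x = 0ℝ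
eval (c ∷ cs) x = fromℤ c + x * eval cs x

IsRoot : List ℤ → ℝ → Set
IsRoot p x = eval p x ≈ 0ℝ

AlgebraicInteger : ℝ → Set
AlgebraicInteger x = ∃[ cs ] IsRoot (cs ++ [ 1ℤ ]) x

-- Membership in ℚ(τ): the subfield of ℝ generated by τ.
data ℚ⟨_⟩ (τ : ℝ) : ℝ → Set where
  gen  : ℚ⟨ τ ⟩ τ
  rat  : ∀ q → ℚ⟨ τ ⟩ (fromℚ q)
  add  : ∀ {x y} → ℚ⟨ τ ⟩ x → ℚ⟨ τ ⟩ y → ℚ⟨ τ ⟩ (x + y)
  neg  : ∀ {x} → ℚ⟨ τ ⟩ x → ℚ⟨ τ ⟩ (- x)
  mul  : ∀ {x y} → ℚ⟨ τ ⟩ x → ℚ⟨ τ ⟩ y → ℚ⟨ τ ⟩ (x * y)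
  recp : ∀ {x} (x#0 : x # 0ℝ) → ℚ⟨ τ ⟩ x → ℚ⟨ τ ⟩ (inv x x#0)
  resp : ∀ {x y} → x ≈ y → ℚ⟨ τ ⟩ x → ℚ⟨ τ ⟩ y

_∈𝒪⟨_⟩ : ℝ → ℝ → Set
x ∈𝒪⟨ τ ⟩ = ℚ⟨ τ ⟩ x × AlgebraicInteger x

IsUnit𝒪 : ℝ → ℝ → Set
IsUnit𝒪 τ ε = ε ∈𝒪⟨ τ ⟩ × ∃[ η ] (η ∈𝒪⟨ τ ⟩ × ε * η ≈ 1ℝ)

-- β₁, β₂, β₃ have indices 0F, 1F, 2F.
vec : ℝ → ℝ → ℝ → Vector ℝ 3
vec x y z 0F = x
vec x y z 1F = y
vec x y z 2F = z

_≈ᵛ_ : Vector ℝ 3 → Vector ℝ 3 → Set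
u ≈ᵛ v = ∀ i → u i ≈ v i

-- Floors of reals are not computable, so a step is a relation.  It determines
-- β′ from β up to ≈, since an integer b with IsFloor x b is unique.
JPAStep : Vector ℝ 3 → Vector ℝ 3 → Set
JPAStep β β′ = Σ (β 0F # 0ℝ) λ β₁#0 → ∃[ b₂ ] ∃[ b₃ ]
  ( IsFloor (β 1F / β 0F [ β₁#0 ]) b₂
  × IsFloor (β 2F / β 0F [ β₁#0 ]) b₃
  × β′ ≈ᵛ vec (β 1F - fromℤ b₂ * β 0F) (β 2F - fromℤ b₃ * β 0F) (β 0F))

IsJPAExpansion : Vector ℝ 3 → (ℕ → Vector ℝ 3) → Set
IsJPAExpansion v β = β 0 ≈ᵛ v × (∀ k → JPAStep (β k) (β (suc k)))

IsPeriodic : ℝ → (ℕ → Vector ℝ 3) → Set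
IsPeriodic τ β = ∃[ l₀ ] ∃[ l₁ ] ∃[ ε ]
  ( 1 ℕ.≤ l₁
  × IsUnit𝒪 τ ε
  × (∀ i k → l₀ ℕ.≤ k → β (k ℕ.+ l₁) i ≈ ε * β k i))

-- Existence is part of the claim: the recursion breaks off if some β₁⁽ᵏ⁾ is 0.
HasPeriodicJPA : ℝ → Vector ℝ 3 → Set
HasPeriodicJPA τ v =
  ∃ (IsJPAExpansion v) × (∀ β → IsJPAExpansion v β → IsPeriodic τ β)

{-# OPTIONS --safe #-}
module Submission where

-- The two polynomials are x (x - 1) (x + a) - 1 and x (x + 1) (x - a) - 1, so the factors are units
-- of ℤ[τ] and their signs, together with one crude comparison, locate the three roots of each.
-- For every root the partial quotients are fixed polynomials in a, and exact arithmetic in ℤ[a][τ]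
-- shows that running them multiplies some vector c by a unit ε.  That they are the true
-- partial quotients means that every later vector (x , y , z) satisfies 0 < x , y < z.  Under a
-- Perron-type condition on the quotients this property passes from a vector to its predecessor,
-- so it only has to be checked for ε c, i.e. for the single explicit vector c.

open import Algebra.Bundles using (CommutativeRing)
import Algebra.Solver.Ring as RingSolver
open import Algebra.Solver.Ring.AlmostCommutativeRing using (fromCommutativeRing; _-Raw-AlmostCommutative⟶_)
open import Data.Bool using (Bool; true; false; T; _∧_; _∨_)
open import Data.Bool.Properties using (T-∧; T-∨)
open import Data.Empty using (⊥-elim)
open import Data.Fin.Patterns using (0F; 1F; 2F)
open import Data.Integer as ℤ using (ℤ; +_; 0ℤ; 1ℤ; -1ℤ; +≤+) renaming (-_ to -ℤ_; _-_ to _-ℤ_; _≥_ to _≥ℤ_)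
import Data.Integer.Properties as ℤ
open import Data.List using (List; []; _∷_; _++_; length)
open import Data.Maybe as Maybe using (Maybe; just; is-just)
open import Data.Nat as ℕ using (ℕ; zero; suc; _⊔_; s≤s; z≤n)
import Data.Nat.Properties as ℕ
open import Data.Product as Product using (Σ; ∃-syntax; _×_; _,_; proj₁; proj₂)
open import Data.Rational as ℚ using (ℚ; 0ℚ; 1ℚ; ½; ∣_∣)
import Data.Rational.Properties as ℚ
open import Data.Rational.Unnormalised as ℚᵘ using (mkℚᵘ)
import Data.Rational.Unnormalised.Properties as ℚᵘ
open import Data.Sum as Sum using (_⊎_; inj₁; inj₂)
open import Data.Vec using ([]; _∷_)
open import Data.Vec.Functional using (Vector)
open import Function.Bundles using (Equivalence)
open import Level using (0ℓ)
import Relation.Binary.Reasoning.Setoid as ≈-Reasoning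
open import Relation.Binary.PropositionalEquality as ≡ using (_≡_)
open import Relation.Nullary using (¬_; yes; no)
open import Relation.Nullary.Decidable using (dec⇒maybe)

-- Over Cauchy reals neither signs nor floors are computable. Every case distinction therefore comes
-- from a stronger fact: a factor of a positive product has a sign, and one of the two summands of a
-- positive sum is positive. This is why the cases on the size of `τ` overlap instead of meeting at
-- a point. Floors are not computed either: the digits are given in advance, and `0 < y - b x < x`
-- certifies each of them. Going backwards matters because a predecessor combines the entries of its
-- successor with natural coefficients, so positivity is inherited without any estimate of `τ`;
-- going forwards, every vector would need its own estimate. The estimates that remain must hold
-- uniformly in `a`, which is therefore written as `n + 3` or `n + 5` with `n` natural.

witness : ∀ {a} {A : Set a} (m : Maybe A) → T (is-just m) → A
witness (just x) _ = x

-- Digits as polynomials in `n`, and Perron's condition on them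

infixl 6 _⊕_
infixl 7 _⊗_

-- Natural coefficients and no subtraction, so that positivity for every `n` is visible in the
-- syntax. The parameter `𝕟` itself may be 0.
data ℕ[n] : Set where
  nat : ℕ → ℕ[n]
  𝕟   : ℕ[n]
  _⊕_ _⊗_ : ℕ[n] → ℕ[n] → ℕ[n]

evaluate : ℕ → ℕ[n] → ℕ
evaluate n (nat k) = k
evaluate n 𝕟       = n
evaluate n (p ⊕ q) = evaluate n p ℕ.+ evaluate n q
evaluate n (p ⊗ q) = evaluate n p ℕ.* evaluate n q

positive? : ℕ[n] → Bool
positive? (nat zero)    = false
positive? (nat (suc _)) = true
positive? 𝕟             = false
positive? (p ⊕ q)       = positive? p ∨ positive? q
positive? (p ⊗ q)       = positive? p ∧ positive? q

positive?-sound : ∀ n p → T (positive? p) → 0 ℕ.< evaluate n p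
positive?-sound n (nat (suc k)) _ = ℕ.z<s
positive?-sound n (p ⊕ q) p∨q with Equivalence.to (T-∨ {positive? p}) p∨q
... | inj₁ p>0 = ℕ.<-≤-trans (positive?-sound n p p>0) (ℕ.m≤m+n _ _)
... | inj₂ q>0 = ℕ.<-≤-trans (positive?-sound n q q>0) (ℕ.m≤n+m _ _)
positive?-sound n (p ⊗ q) p∧q with p>0 , q>0 ← Equivalence.to (T-∧ {positive? p}) p∧q =
  ℕ.*-mono-< (positive?-sound n p p>0) (positive?-sound n q q>0)

-- (b , d) stands for the partial quotients b₂ = b and b₃ = b + d.
Digit : Set
Digit = ℕ[n] × ℕ[n]

leading-positive : List Digit → Bool
leading-positive []            = false
leading-positive ((b , _) ∷ _) = positive? b

-- A sufficient form of Perron's condition: b₂ < b₃, or 0 < b₂ ≤ b₃ and the next b₂ is positive.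
admissible : List Digit → Bool
admissible []             = true
admissible ((b , d) ∷ ds) =
  (positive? d ∨ (positive? b ∧ leading-positive ds)) ∧ admissible ds

-- Constructive ordered fields

-- Abstract because the operations of ℝ unfold on variables, which makes ring solving over ℝ too slow.
record OrderedField : Set₁ where
  field
    commutativeRing : CommutativeRing 0ℓ 0ℓ
  open CommutativeRing commutativeRing public
  field
    ι           : ℤ → Carrier
    ι-+         : ∀ i j → ι (i ℤ.+ j) ≈ ι i + ι j
    ι-*         : ∀ i j → ι (i ℤ.* j) ≈ ι i * ι j
    ι-neg       : ∀ i → ι (ℤ.- i) ≈ - ι i
    ι-0         : ι 0ℤ ≈ 0#
    ι-1         : ι 1ℤ ≈ 1#
    Positive    : Carrier → Set
    pos-resp    : ∀ {x y} → x ≈ y → Positive x → Positive y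
    pos-+       : ∀ {x y} → Positive x → Positive y → Positive (x + y)
    pos-*       : ∀ {x y} → Positive x → Positive y → Positive (x * y)
    pos-ι       : ∀ n → Positive (ι (+ suc n))
    ¬pos-0      : ¬ Positive 0#
    pos-split   : ∀ {x y} → Positive (x + y) → Positive x ⊎ Positive y
    pos-factor  : ∀ {x y} → Positive (x * y) → Positive x ⊎ Positive (- x)
    inverse     : ∀ {x} → Positive x → ∃[ y ] x * y ≈ 1#

module OrderedFieldProperties (F : OrderedField) where
  open OrderedField F public

  homo : ℤ.+-*-rawRing -Raw-AlmostCommutative⟶ fromCommutativeRing commutativeRing
  homo = record
    { ⟦_⟧ = ι ; +-homo = ι-+ ; *-homo = ι-* ; -‿homo = ι-neg ; 0-homo = ι-0 ; 1-homo = ι-1 }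

  ι≟ : ∀ i j → Maybe (ι i ≈ ι j)
  ι≟ i j = Maybe.map (λ i≡j → reflexive (≡.cong ι i≡j)) (dec⇒maybe (i ℤ.≟ j))

  open RingSolver ℤ.+-*-rawRing (fromCommutativeRing commutativeRing) homo ι≟ public

  ¬pos∧neg : ∀ {x} → Positive x → ¬ Positive (- x)
  ¬pos∧neg p q = ¬pos-0 (pos-resp (-‿inverseʳ _) (pos-+ p q))

  pos-cancel : ∀ {x y} → Positive (x * y) → Positive x → Positive y
  pos-cancel {x} {y} pxy px with pos-factor (pos-resp (*-comm x y) pxy)
  ... | inj₁ py  = py
  ... | inj₂ p-y = ⊥-elim (¬pos∧neg pxy (pos-resp
    (solve 2 (λ x y → x :* :- y := :- (x :* y)) refl x y) (pos-* px p-y)))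

  invertible-sign : ∀ {x y} → x * y ≈ 1# → Positive x ⊎ Positive (- x)
  invertible-sign xy≈1 = pos-factor (pos-resp (trans ι-1 (sym xy≈1)) (pos-ι 0))

  -- A natural number rather than an order relation: adding `k * x` is then repeated addition of
  -- `x`, and only the strict order is involved.
  Nonneg : Carrier → Set
  Nonneg k = ∃[ n ] ι (+ n) ≈ k

  pos+nonneg* : ∀ {k x y} → Nonneg k → Positive x → Positive y → Positive (y + k * x)
  pos+nonneg* {k} {x} {y} (n , n≈k) px py = pos-resp (+-congˡ (*-congʳ n≈k)) (go n)
    where
    go : ∀ n → Positive (y + ι (+ n) * x)
    go zero    = pos-resp (solve 2 (λ x y → y := y :+ con 0ℤ :* x) refl x y) py
    go (suc n) = pos-+ py (pos-* (pos-ι n) px)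

  -- The sign of the middle factor is decided first. If `y` is positive, so is the larger `x`, hence
  -- also `z`; if `y` is negative, so is the smaller `z`, hence `x` is positive. It is applied to
  -- the three linear factors in the equation of `τ`.
  signs-of-product : ∀ {x y z} → x * y * z ≈ 1# → Positive (x - y) → Positive (y - z) →
                     Positive z ⊎ (Positive x × Positive (- y))
  signs-of-product {x} {y} {z} xyz≈1 x>y y>z = by-sign-y (pos-factor (pos-resp
      (solve 3 (λ x y z → x :* y :* z := y :* (x :* z)) refl x y z) pos-xyz))
    where
    pos-xyz : Positive (x * y * z)
    pos-xyz = pos-resp (trans ι-1 (sym xyz≈1)) (pos-ι 0)

    by-sign-y : Positive y ⊎ Positive (- y) → Positive z ⊎ (Positive x × Positive (- y))
    by-sign-y (inj₁ py) = inj₁ (pos-cancel pos-xyz (pos-* (pos-resp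
      (solve 2 (λ x y → x :- y :+ y := x) refl x y) (pos-+ x>y py)) py))
    by-sign-y (inj₂ p-y) = inj₂ (pos-cancel
        (pos-resp (solve 3 (λ x y z → x :* y :* z := (:- y :* :- z) :* x) refl x y z) pos-xyz)
        (pos-* p-y p-z)
      , p-y)
      where
      p-z = pos-resp (solve 2 (λ y z → y :- z :+ :- y := :- z) refl y z) (pos-+ y>z p-y)

  -- Reduced vectors and the backward step

  record Reduced (x y z : Carrier) : Set where
    constructor reduced
    field
      0<x : Positive x
      0<y : Positive y
      x<z : Positive (z - x)
      y<z : Positive (z - y)

  reduced-resp : ∀ {x y z x′ y′ z′} → x ≈ x′ → y ≈ y′ → z ≈ z′ → Reduced x y z → Reduced x′ y′ z′
  reduced-resp x≈ y≈ z≈ (reduced 0<x 0<y x<z y<z) = reduced (pos-resp x≈ 0<x) (pos-resp y≈ 0<y)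
    (pos-resp (+-cong z≈ (-‿cong x≈)) x<z) (pos-resp (+-cong z≈ (-‿cong y≈)) y<z)

  -- The vector assumed to be reduced is the successor of (x , y , z).
  module _ {x y z : Carrier} (b d : ℕ)
    (r : Reduced (y - ι (+ b) * x) (z - ι (+ (b ℕ.+ d)) * x) x) where
    open Reduced r renaming (0<x to 0<x′; 0<y to 0<y′; x<z to x′<x; y<z to y′<x)

    private
      B = ι (+ b)
      D = ι (+ d)

      b+d : ι (+ (b ℕ.+ d)) ≈ B + D
      b+d = ι-+ (+ b) (+ d)

      0<y″ : Positive (z - (B + D) * x)
      0<y″ = pos-resp (+-congˡ (-‿cong (*-congʳ b+d))) 0<y′

      0<x : Positive x
      0<x = pos-resp (solve 2 (λ u x → u :+ (x :- u) := x) refl (y - B * x) x) (pos-+ 0<x′ x′<x)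

      one-less : ∀ {m} → 0 ℕ.< m → Nonneg (ι (+ m) - 1#)
      one-less {suc m} _ = m , trans
        (solve 1 (λ m → m := (con 1ℤ :+ m) :- con 1ℤ) refl (ι (+ m)))
        (+-cong (sym (ι-+ 1ℤ (+ m))) (-‿cong ι-1))

      above : ∀ {w k} → Nonneg k → Positive w → Positive (w + k * x)
      above k≥0 = pos+nonneg* k≥0 0<x

    -- Here `y - x = (y - b x) + (b - 1) x`. This supplies the comparison `x′ < y′` that is wanted
    -- one step earlier when the two partial quotients coincide.
    increasing : 0 ℕ.< b → Positive (y - x)
    increasing 0<b = pos-resp
      (trans (+-congˡ (*-congʳ (+-congˡ (-‿cong (sym ι-1)))))
        (solve 3 (λ x y b → (y :- b :* x) :+ (b :- con 1ℤ) :* x := y :- x) refl x y B))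
      (above (one-less 0<b) 0<x′)

    -- If the successor is `(x′ , y′ , x)`, then `z - x = y′ + (b + d - 1) x` and
    -- `z - y = (y′ - x′) + d x`. For `d ≥ 1` the latter is positive because `x′ < x`; for `d = 0`
    -- it reduces to `x′ < y′`, which is why the second alternative asks for that.
    reduced-before : 0 ℕ.< d ⊎ (0 ℕ.< b × Positive ((z - ι (+ (b ℕ.+ d)) * x) - (y - B * x))) →
                     Reduced x y z
    reduced-before c = reduced 0<x
      (pos-resp (solve 3 (λ x y b → (y :- b :* x) :+ b :* x := y) refl x y B) (above (b , refl) 0<x′))
      (pos-resp
        (trans (+-congˡ (*-congʳ (+-congˡ (-‿cong (sym ι-1)))))
          (solve 3 (λ x z c → (z :- c :* x) :+ (c :- con 1ℤ) :* x := z :- x) refl x z (ι (+ (b ℕ.+ d)))))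
        (above (one-less (0<b+d c)) 0<y′))
      (y<z c)
      where
      0<b+d : ∀ {p} {P : Set p} → 0 ℕ.< d ⊎ (0 ℕ.< b × P) → 0 ℕ.< b ℕ.+ d
      0<b+d (inj₁ 0<d)       = ℕ.<-≤-trans 0<d (ℕ.m≤n+m d b)
      0<b+d (inj₂ (0<b , _)) = ℕ.<-≤-trans 0<b (ℕ.m≤m+n b d)

      y<z : 0 ℕ.< d ⊎ (0 ℕ.< b × Positive ((z - ι (+ (b ℕ.+ d)) * x) - (y - B * x))) → Positive (z - y)
      y<z (inj₁ 0<d) = pos-resp
        (trans (+-congˡ (*-congʳ (+-congˡ (-‿cong (sym ι-1)))))
          (solve 5 (λ x y z b d →
              ((z :- (b :+ d) :* x) :+ (x :- (y :- b :* x))) :+ (d :- con 1ℤ) :* x := z :- y)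
            refl x y z B D))
        (above (one-less 0<d) (pos-+ 0<y″ x′<x))
      y<z (inj₂ (_ , x′<y′)) = pos-resp
        (solve 5 (λ x y z b d → ((z :- (b :+ d) :* x) :- (y :- b :* x)) :+ d :* x := z :- y)
          refl x y z B D)
        (above (d , refl) (pos-resp (+-congʳ (+-congˡ (-‿cong (*-congʳ b+d)))) x′<y′))

  quotient-scaled : ∀ {ε x y x′ y′ i j} → x′ ≈ ε * x → y′ ≈ ε * y → x * i ≈ 1# → x′ * j ≈ 1# →
                    y * i ≈ y′ * j
  quotient-scaled {ε} {x} {y} {x′} {y′} {i} {j} x′≈ y′≈ xi≈1 x′j≈1 = begin
    y * i                 ≈⟨ trans (sym (*-identityʳ _)) (*-congˡ (sym x′j≈1)) ⟩
    y * i * (x′ * j)      ≈⟨ *-congˡ (*-congʳ x′≈) ⟩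
    y * i * (ε * x * j)   ≈⟨ solve 5 (λ ε x y i j → y :* i :* (ε :* x :* j) := ε :* y :* j :* (x :* i))
                               refl ε x y i j ⟩
    ε * y * j * (x * i)   ≈⟨ trans (*-congˡ xi≈1) (*-identityʳ _) ⟩
    ε * y * j             ≈⟨ *-congʳ (sym y′≈) ⟩
    y′ * j                ∎
    where open ≈-Reasoning setoid

  difference-scaled : ∀ {ε x y x′ y′} b → x′ ≈ ε * x → y′ ≈ ε * y → y′ - b * x′ ≈ ε * (y - b * x)
  difference-scaled {ε} {x} {y} b x′≈ y′≈ = trans (+-cong y′≈ (-‿cong (*-congˡ x′≈)))
    (solve 4 (λ ε x y b → ε :* y :- b :* (ε :* x) := ε :* (y :- b :* x)) refl ε x y b)

  -- Floors and their uniqueness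

  Floor : Carrier → ℤ → Set
  Floor x b = ¬ Positive (ι b - x) × Positive (ι (b ℤ.+ 1ℤ) - x)

  difference-nonneg : ∀ {i j} → i ℤ.≤ j → Nonneg (ι j - ι i)
  difference-nonneg {i} {j} i≤j = ℤ.∣ j ℤ.- i ∣ , trans
    (reflexive (≡.cong ι (ℤ.0≤i⇒+∣i∣≡i (ℤ.i≤j⇒0≤j-i i≤j))))
    (trans (ι-+ j (ℤ.- i)) (+-congˡ (ι-neg i)))

  floor-resp : ∀ {x y b} → x ≈ y → Floor x b → Floor y b
  floor-resp x≈y (b≤x , x<b+1) =
      (λ y<b → b≤x (pos-resp (+-congˡ (-‿cong (sym x≈y))) y<b))
    , pos-resp (+-congˡ (-‿cong x≈y)) x<b+1

  -- The order of the integers is decidable although that of the field is not: `c < b` would give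
  -- `y < c + 1 ≤ b`, against `b ≤ x`.
  floor-≤ : ∀ {x y b c} → x ≈ y → Floor x b → Floor y c → b ℤ.≤ c
  floor-≤ {x} {y} {b} {c} x≈y (b≤x , _) (_ , y<c+1) = ℤ.≮⇒≥ λ c<b →
    b≤x (pos-resp
      (trans (solve 3 (λ y b c → c :- y :+ (b :- c) :* con 1ℤ := b :- y) refl y (ι b) (ι (c ℤ.+ 1ℤ)))
        (+-congˡ (-‿cong (sym x≈y))))
      (pos+nonneg*
        (difference-nonneg (≡.subst (ℤ._≤ b) (ℤ.+-comm 1ℤ c) (ℤ.i<j⇒suc[i]≤j c<b))) (pos-ι 0) y<c+1))

  floor-unique : ∀ {x y b c} → x ≈ y → Floor x b → Floor y c → b ≡ c
  floor-unique x≈y x-floor y-floor =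
    ℤ.≤-antisym (floor-≤ x≈y x-floor y-floor) (floor-≤ (sym x≈y) y-floor x-floor)

  floor-quotient : ∀ {q x y} b → q * x ≈ y → Positive x → Positive (y - ι b * x) →
                   Positive (x - (y - ι b * x)) → Floor q b
  floor-quotient {q} {x} {y} b qx≈y 0<x 0<r r<x =
      (λ q<b → ¬pos∧neg 0<r (pos-resp
        (trans (solve 3 (λ q x b → (b :- q) :* x := :- (q :* x :- b :* x)) refl q x (ι b))
          (-‿cong (+-congʳ qx≈y)))
        (pos-* q<b 0<x)))
    , pos-cancel (pos-resp (begin
        x - (y - ι b * x)           ≈⟨ +-congˡ (-‿cong (+-congʳ (sym qx≈y))) ⟩
        x - (q * x - ι b * x)       ≈⟨ solve 3 (λ q x b → x :- (q :* x :- b :* x) := x :* (b :+ con 1ℤ :- q))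
                                         refl q x (ι b) ⟩
        x * (ι b + ι 1ℤ - q)        ≈⟨ *-congˡ (+-congʳ (sym (ι-+ b 1ℤ))) ⟩
        x * (ι (b ℤ.+ 1ℤ) - q)      ∎) r<x) 0<x
    where open ≈-Reasoning setoid

  reduced-scaled : ∀ {ε x y z} → Positive ε → Reduced x y z → Reduced (ε * x) (ε * y) (ε * z)
  reduced-scaled {ε} {x} {y} {z} 0<ε (reduced 0<x 0<y x<z y<z) =
    reduced (pos-* 0<ε 0<x) (pos-* 0<ε 0<y)
      (pos-resp (solve 3 (λ ε x z → ε :* (z :- x) := ε :* z :- ε :* x) refl ε x z) (pos-* 0<ε x<z))
      (pos-resp (solve 3 (λ ε y z → ε :* (z :- y) := ε :* z :- ε :* y) refl ε y z) (pos-* 0<ε y<z))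

  -- Characteristic polynomials and integrality

  module Characteristic (ξ y z m₀₀ m₀₁ m₀₂ m₁₀ m₁₁ m₁₂ m₂₀ m₂₁ m₂₂ : Carrier)
    (row₀ : m₀₀ + m₀₁ * y + m₀₂ * z ≈ ξ)
    (row₁ : m₁₀ + m₁₁ * y + m₁₂ * z ≈ y * ξ)
    (row₂ : m₂₀ + m₂₁ * y + m₂₂ * z ≈ z * ξ) where

    trace minors determinant : Carrier
    trace = m₀₀ + m₁₁ + m₂₂
    minors = (m₀₀ * m₁₁ - m₀₁ * m₁₀) + (m₀₀ * m₂₂ - m₀₂ * m₂₀) + (m₁₁ * m₂₂ - m₁₂ * m₂₁)
    determinant = m₀₀ * (m₁₁ * m₂₂ - m₁₂ * m₂₁) - m₀₁ * (m₁₀ * m₂₂ - m₁₂ * m₂₀)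
                + m₀₂ * (m₁₀ * m₂₁ - m₁₁ * m₂₀)

    -- The first column of the adjugate of ξ - M, applied to (ξ - M)(1 , y , z) = 0.
    cayley-hamilton : - determinant + ξ * (minors + ξ * (- trace + ξ * (ι 1ℤ + ξ * 0#))) ≈ 0#
    cayley-hamilton = begin
      - determinant + ξ * (minors + ξ * (- trace + ξ * (ι 1ℤ + ξ * 0#)))
        ≈⟨ +-congˡ (*-congˡ (+-congˡ (*-congˡ (+-congˡ (*-congˡ (+-congˡ (zeroʳ ξ))))))) ⟩
      - determinant + ξ * (minors + ξ * (- trace + ξ * (ι 1ℤ + 0#)))
        ≈⟨ +-congˡ (*-congˡ (+-congˡ (*-congˡ (+-congˡ (*-congˡ (+-identityʳ _)))))) ⟩
      - determinant + ξ * (minors + ξ * (- trace + ξ * ι 1ℤ))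
        ≈⟨ solve 12 (λ x y z a b c d e f g h i →
             (:- (a :* (e :* i :- f :* h) :- b :* (d :* i :- f :* g) :+ c :* (d :* h :- e :* g)))
             :+ x :* (((a :* e :- b :* d) :+ (a :* i :- c :* g) :+ (e :* i :- f :* h))
               :+ x :* (:- (a :+ e :+ i) :+ x :* con 1ℤ))
             := ((x :- e) :* (x :- i) :- f :* h) :* (x :- (a :+ b :* y :+ c :* z))
             :+ (b :* (x :- i) :+ c :* h) :* (y :* x :- (d :+ e :* y :+ f :* z))
             :+ (b :* f :+ c :* (x :- e)) :* (z :* x :- (g :+ h :* y :+ i :* z)))
             refl ξ y z m₀₀ m₀₁ m₀₂ m₁₀ m₁₁ m₁₂ m₂₀ m₂₁ m₂₂ ⟩
      adj₀ * (ξ - (m₀₀ + m₀₁ * y + m₀₂ * z)) + adj₁ * (y * ξ - (m₁₀ + m₁₁ * y + m₁₂ * z))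
        + adj₂ * (z * ξ - (m₂₀ + m₂₁ * y + m₂₂ * z))
        ≈⟨ +-cong (+-cong (vanish row₀) (vanish row₁)) (vanish row₂) ⟩
      0# + 0# + 0#
        ≈⟨ trans (+-identityʳ _) (+-identityʳ _) ⟩
      0# ∎
      where
      open ≈-Reasoning setoid
      adj₀ = (ξ - m₁₁) * (ξ - m₂₂) - m₁₂ * m₂₁
      adj₁ = m₀₁ * (ξ - m₂₂) + m₀₂ * m₂₁
      adj₂ = m₀₁ * m₁₂ + m₀₂ * (ξ - m₁₁)
      vanish : ∀ {c p q} → p ≈ q → c * (q - p) ≈ 0#
      vanish p≈q = trans (*-congˡ (trans (+-congˡ (-‿cong p≈q)) (-‿inverseʳ _))) (zeroʳ _)

  Integral : Carrier → Set
  Integral x = ∃[ i ] ι i ≈ x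

  data ℤ[_] (τ : Carrier) : Carrier → Set where
    gen  : ℤ[ τ ] τ
    int  : ∀ i → ℤ[ τ ] (ι i)
    add  : ∀ {x y} → ℤ[ τ ] x → ℤ[ τ ] y → ℤ[ τ ] (x + y)
    mul  : ∀ {x y} → ℤ[ τ ] x → ℤ[ τ ] y → ℤ[ τ ] (x * y)
    resp : ∀ {x y} → x ≈ y → ℤ[ τ ] x → ℤ[ τ ] y

  -- The trailing `ξ * 0#` is what `eval` leaves for the empty list, so over `ℝ` this equation is by
  -- definition `IsRoot` of a monic list of coefficients.
  CubicInteger : Carrier → Set
  CubicInteger ξ = ∃[ k₀ ] ∃[ k₁ ] ∃[ k₂ ]
    ι k₀ + ξ * (ι k₁ + ξ * (ι k₂ + ξ * (ι 1ℤ + ξ * 0#))) ≈ 0#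

  integral-+ : ∀ {x y} → Integral x → Integral y → Integral (x + y)
  integral-+ (i , i≈x) (j , j≈y) = i ℤ.+ j , trans (ι-+ i j) (+-cong i≈x j≈y)

  integral-* : ∀ {x y} → Integral x → Integral y → Integral (x * y)
  integral-* (i , i≈x) (j , j≈y) = i ℤ.* j , trans (ι-* i j) (*-cong i≈x j≈y)

  integral-neg : ∀ {x} → Integral x → Integral (- x)
  integral-neg (i , i≈x) = ℤ.- i , trans (ι-neg i) (-‿cong i≈x)

  -- Exact arithmetic modulo the cubic

  -- ℤ[n][τ] for a root τ of x³ = 1 + v x + w x², with coordinates with respect to 1, τ, τ².
  module CubicOrder (n : ℕ) (τ : Carrier) (v w : Polynomial 1)
    (cubic : τ * (τ * τ) ≈ 1# + ⟦ v ⟧ (ι (+ n) ∷ []) * τ + ⟦ w ⟧ (ι (+ n) ∷ []) * (τ * τ)) where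

    Elem : Set
    Elem = Normal 1 × Normal 1 × Normal 1

    ⟦_⟧₁ : Normal 1 → Carrier
    ⟦ c ⟧₁ = ⟦ c ⟧N (ι (+ n) ∷ [])

    ⟦_⟧ᴱ : Elem → Carrier
    ⟦ c₀ , c₁ , c₂ ⟧ᴱ = ⟦ c₀ ⟧₁ + ⟦ c₁ ⟧₁ * τ + ⟦ c₂ ⟧₁ * (τ * τ)

    infixl 6 _+ᴱ_
    infixl 7 _*ᴱ_ _∙ᴱ_

    scalar : Normal 1 → Elem
    scalar c = c , 0N , 0N

    _+ᴱ_ : Elem → Elem → Elem
    (c₀ , c₁ , c₂) +ᴱ (d₀ , d₁ , d₂) = c₀ +N d₀ , c₁ +N d₁ , c₂ +N d₂

    _∙ᴱ_ : Normal 1 → Elem → Elem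
    c ∙ᴱ (d₀ , d₁ , d₂) = c *N d₀ , c *N d₁ , c *N d₂

    τ∙ : Elem → Elem
    τ∙ (c₀ , c₁ , c₂) = c₂ , c₀ +N normalise v *N c₂ , c₁ +N normalise w *N c₂

    _*ᴱ_ : Elem → Elem → Elem
    (c₀ , c₁ , c₂) *ᴱ d = (c₀ ∙ᴱ d) +ᴱ ((c₁ ∙ᴱ τ∙ d) +ᴱ (c₂ ∙ᴱ τ∙ (τ∙ d)))

    private
      ρ₁ : Env 1
      ρ₁ = ι (+ n) ∷ []

    scalar-homo : ∀ c → ⟦ scalar c ⟧ᴱ ≈ ⟦ c ⟧₁
    scalar-homo c = trans
      (+-cong (+-congˡ (trans (*-congʳ (0N-homo ρ₁)) (zeroˡ _))) (trans (*-congʳ (0N-homo ρ₁)) (zeroˡ _)))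
      (trans (+-identityʳ _) (+-identityʳ _))

    +ᴱ-homo : ∀ x y → ⟦ x +ᴱ y ⟧ᴱ ≈ ⟦ x ⟧ᴱ + ⟦ y ⟧ᴱ
    +ᴱ-homo (c₀ , c₁ , c₂) (d₀ , d₁ , d₂) = trans
      (+-cong (+-cong (+N-homo c₀ d₀ ρ₁) (*-congʳ (+N-homo c₁ d₁ ρ₁))) (*-congʳ (+N-homo c₂ d₂ ρ₁)))
      (solve 7 (λ c₀ c₁ c₂ d₀ d₁ d₂ t →
          (c₀ :+ d₀) :+ (c₁ :+ d₁) :* t :+ (c₂ :+ d₂) :* (t :* t)
          := (c₀ :+ c₁ :* t :+ c₂ :* (t :* t)) :+ (d₀ :+ d₁ :* t :+ d₂ :* (t :* t)))
        refl ⟦ c₀ ⟧₁ ⟦ c₁ ⟧₁ ⟦ c₂ ⟧₁ ⟦ d₀ ⟧₁ ⟦ d₁ ⟧₁ ⟦ d₂ ⟧₁ τ)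

    ∙ᴱ-homo : ∀ c x → ⟦ c ∙ᴱ x ⟧ᴱ ≈ ⟦ c ⟧₁ * ⟦ x ⟧ᴱ
    ∙ᴱ-homo c (d₀ , d₁ , d₂) = trans
      (+-cong (+-cong (*N-homo c d₀ ρ₁) (*-congʳ (*N-homo c d₁ ρ₁))) (*-congʳ (*N-homo c d₂ ρ₁)))
      (solve 5 (λ c d₀ d₁ d₂ t →
          c :* d₀ :+ c :* d₁ :* t :+ c :* d₂ :* (t :* t) := c :* (d₀ :+ d₁ :* t :+ d₂ :* (t :* t)))
        refl ⟦ c ⟧₁ ⟦ d₀ ⟧₁ ⟦ d₁ ⟧₁ ⟦ d₂ ⟧₁ τ)

    τ∙-homo : ∀ x → ⟦ τ∙ x ⟧ᴱ ≈ τ * ⟦ x ⟧ᴱ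
    τ∙-homo (c₀ , c₁ , c₂) = begin
      ⟦ c₂ ⟧₁ + ⟦ c₀ +N normalise v *N c₂ ⟧₁ * τ + ⟦ c₁ +N normalise w *N c₂ ⟧₁ * (τ * τ)
        ≈⟨ +-cong (+-congˡ (*-congʳ (add-mul c₀ v))) (*-congʳ (add-mul c₁ w)) ⟩
      ⟦ c₂ ⟧₁ + (⟦ c₀ ⟧₁ + ⟦ v ⟧ ρ₁ * ⟦ c₂ ⟧₁) * τ + (⟦ c₁ ⟧₁ + ⟦ w ⟧ ρ₁ * ⟦ c₂ ⟧₁) * (τ * τ)
        ≈⟨ solve 6 (λ c₀ c₁ c₂ v w t →
             c₂ :+ (c₀ :+ v :* c₂) :* t :+ (c₁ :+ w :* c₂) :* (t :* t)
             := c₀ :* t :+ c₁ :* (t :* t) :+ c₂ :* (con 1ℤ :+ v :* t :+ w :* (t :* t)))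
             refl ⟦ c₀ ⟧₁ ⟦ c₁ ⟧₁ ⟦ c₂ ⟧₁ (⟦ v ⟧ ρ₁) (⟦ w ⟧ ρ₁) τ ⟩
      ⟦ c₀ ⟧₁ * τ + ⟦ c₁ ⟧₁ * (τ * τ) + ⟦ c₂ ⟧₁ * (ι 1ℤ + ⟦ v ⟧ ρ₁ * τ + ⟦ w ⟧ ρ₁ * (τ * τ))
        ≈⟨ +-congˡ (*-congˡ (trans (+-congʳ (+-congʳ ι-1)) (sym cubic))) ⟩
      ⟦ c₀ ⟧₁ * τ + ⟦ c₁ ⟧₁ * (τ * τ) + ⟦ c₂ ⟧₁ * (τ * (τ * τ))
        ≈⟨ solve 4 (λ c₀ c₁ c₂ t →
             c₀ :* t :+ c₁ :* (t :* t) :+ c₂ :* (t :* (t :* t))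
             := t :* (c₀ :+ c₁ :* t :+ c₂ :* (t :* t)))
             refl ⟦ c₀ ⟧₁ ⟦ c₁ ⟧₁ ⟦ c₂ ⟧₁ τ ⟩
      τ * (⟦ c₀ ⟧₁ + ⟦ c₁ ⟧₁ * τ + ⟦ c₂ ⟧₁ * (τ * τ)) ∎
      where
      open ≈-Reasoning setoid
      add-mul : ∀ c p → ⟦ c +N normalise p *N c₂ ⟧₁ ≈ ⟦ c ⟧₁ + ⟦ p ⟧ ρ₁ * ⟦ c₂ ⟧₁
      add-mul c p = trans (+N-homo c (normalise p *N c₂) ρ₁)
        (+-congˡ (trans (*N-homo (normalise p) c₂ ρ₁) (*-congʳ (correct p ρ₁))))

    *ᴱ-homo : ∀ x y → ⟦ x *ᴱ y ⟧ᴱ ≈ ⟦ x ⟧ᴱ * ⟦ y ⟧ᴱ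
    *ᴱ-homo (c₀ , c₁ , c₂) y = begin
      ⟦ (c₀ ∙ᴱ y) +ᴱ ((c₁ ∙ᴱ τ∙ y) +ᴱ (c₂ ∙ᴱ τ∙ (τ∙ y))) ⟧ᴱ
        ≈⟨ trans (+ᴱ-homo (c₀ ∙ᴱ y) _) (+-congˡ (+ᴱ-homo (c₁ ∙ᴱ τ∙ y) (c₂ ∙ᴱ τ∙ (τ∙ y)))) ⟩
      ⟦ c₀ ∙ᴱ y ⟧ᴱ + (⟦ c₁ ∙ᴱ τ∙ y ⟧ᴱ + ⟦ c₂ ∙ᴱ τ∙ (τ∙ y) ⟧ᴱ)
        ≈⟨ +-cong (∙ᴱ-homo c₀ y) (+-cong
             (trans (∙ᴱ-homo c₁ (τ∙ y)) (*-congˡ (τ∙-homo y)))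
             (trans (∙ᴱ-homo c₂ (τ∙ (τ∙ y))) (*-congˡ (trans (τ∙-homo (τ∙ y)) (*-congˡ (τ∙-homo y)))))) ⟩
      ⟦ c₀ ⟧₁ * ⟦ y ⟧ᴱ + (⟦ c₁ ⟧₁ * (τ * ⟦ y ⟧ᴱ) + ⟦ c₂ ⟧₁ * (τ * (τ * ⟦ y ⟧ᴱ)))
        ≈⟨ solve 5 (λ c₀ c₁ c₂ t y →
             c₀ :* y :+ (c₁ :* (t :* y) :+ c₂ :* (t :* (t :* y)))
             := (c₀ :+ c₁ :* t :+ c₂ :* (t :* t)) :* y)
             refl ⟦ c₀ ⟧₁ ⟦ c₁ ⟧₁ ⟦ c₂ ⟧₁ τ ⟦ y ⟧ᴱ ⟩
      (⟦ c₀ ⟧₁ + ⟦ c₁ ⟧₁ * τ + ⟦ c₂ ⟧₁ * (τ * τ)) * ⟦ y ⟧ᴱ ∎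
      where open ≈-Reasoning setoid

    -- The variables of a polynomial stand for n and τ.
    reduce : Polynomial 2 → Elem
    reduce (op [+] p q)  = reduce p +ᴱ reduce q
    reduce (op [*] p q)  = reduce p *ᴱ reduce q
    reduce (con c)       = scalar (normalise (con c))
    reduce (var 0F)      = scalar (normalise (var 0F))
    reduce (var 1F)      = τ∙ (scalar 1N)
    reduce (p :^ zero)   = scalar 1N
    reduce (p :^ suc k)  = reduce p *ᴱ reduce (p :^ k)
    reduce (:- p)        = scalar (-N 1N) *ᴱ reduce p

    value : Polynomial 2 → Carrier
    value p = ⟦ p ⟧ (ι (+ n) ∷ τ ∷ [])

    reduce-correct : ∀ p → ⟦ reduce p ⟧ᴱ ≈ value p
    reduce-correct (op [+] p q) =
      trans (+ᴱ-homo (reduce p) (reduce q)) (+-cong (reduce-correct p) (reduce-correct q))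
    reduce-correct (op [*] p q) =
      trans (*ᴱ-homo (reduce p) (reduce q)) (*-cong (reduce-correct p) (reduce-correct q))
    reduce-correct (con c)      = trans (scalar-homo (normalise (con c))) (correct (con c) ρ₁)
    reduce-correct (var 0F)     = trans (scalar-homo (normalise (var 0F))) (correct (var 0F) ρ₁)
    reduce-correct (var 1F)     = trans (τ∙-homo (scalar 1N))
      (trans (*-congˡ (trans (scalar-homo 1N) (1N-homo ρ₁))) (*-identityʳ τ))
    reduce-correct (p :^ zero)  = trans (scalar-homo 1N) (1N-homo ρ₁)
    reduce-correct (p :^ suc k) =
      trans (*ᴱ-homo (reduce p) (reduce (p :^ k))) (*-cong (reduce-correct p) (reduce-correct (p :^ k)))
    reduce-correct (:- p)       = trans (*ᴱ-homo (scalar (-N 1N)) (reduce p))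
      (trans (*-cong (trans (scalar-homo (-N 1N)) (trans (-N‿-homo 1N ρ₁) (-‿cong (1N-homo ρ₁)))) (reduce-correct p))
        (trans (*-congʳ (-‿cong (sym ι-1))) (solve 1 (λ x → :- con 1ℤ :* x := :- x) refl (value p))))

    _≟ᴱ_ : ∀ x y → Maybe (⟦ x ⟧ᴱ ≈ ⟦ y ⟧ᴱ)
    (c₀ , c₁ , c₂) ≟ᴱ (d₀ , d₁ , d₂) = Maybe.zipWith (λ (eq₀ , eq₁) eq₂ →
        +-cong (+-cong (⟦ eq₀ ⟧N-cong ρ₁) (*-congʳ (⟦ eq₁ ⟧N-cong ρ₁))) (*-congʳ (⟦ eq₂ ⟧N-cong ρ₁)))
      (Maybe.zip (c₀ ≟N d₀) (c₁ ≟N d₁)) (c₂ ≟N d₂)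

    -- Normal forms over ℤ[n] are compared during type checking. On success this type computes to
    -- the unit type, so the implicit arguments of this form are filled in silently, for all `n` at
    -- once.
    _≈?_ : Elem → Elem → Set
    x ≈? y = T (is-just (x ≟ᴱ y))

    ≈?-sound : ∀ x y → x ≈? y → ⟦ x ⟧ᴱ ≈ ⟦ y ⟧ᴱ
    ≈?-sound x y = witness (x ≟ᴱ y)

    value-≈ : ∀ p q → reduce p ≈? reduce q → value p ≈ value q
    value-≈ p q eq =
      trans (sym (reduce-correct p)) (trans (≈?-sound (reduce p) (reduce q) eq) (reduce-correct q))

    -- Positivity certificates

    -- A record, so that p can be inferred from a proof.
    record Pos (p : Polynomial 2) : Set where
      constructor positive
      field value-positive : Positive (value p)
    open Pos public

    infixr 5 n⊞_
    infixl 6 _⊞_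
    infixl 7 _⊠_

    _⊞_ : ∀ {p q} → Pos p → Pos q → Pos (p :+ q)
    positive x ⊞ positive y = positive (pos-+ x y)

    _⊠_ : ∀ {p q} → Pos p → Pos q → Pos (p :* q)
    positive x ⊠ positive y = positive (pos-* x y)

    lit : ∀ k → Pos (con (+ suc k))
    lit k = positive (pos-ι k)

    n⊞_ : ∀ {p} → Pos p → Pos (var 0F :+ p)
    n⊞ positive x = positive (pos-resp
      (solve 2 (λ k x → x :+ k :* con 1ℤ := k :+ x) refl (ι (+ n)) _)
      (pos+nonneg* (n , refl) (pos-ι 0) x))

    -- The equality is tested modulo the cubic and not just as a ring identity. A typical
    -- certificate replaces 1 by the product of unit factors that equals it, and then pulls out a
    -- factor known to be positive.
    rewritten : ∀ {p q} → Pos q → {reduce q ≈? reduce p} → Pos p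
    rewritten {p} {q} (positive x) {eq} = positive (pos-resp (value-≈ q p eq) x)

    -- In the applications `p` is an integer constant that clears denominators, so that rational
    -- bounds need no fractions.
    divided : ∀ p {q r} → Pos r → Pos p → {reduce r ≈? reduce (p :* q)} → Pos q
    divided p {q} {r} (positive z) (positive x) {eq} =
      positive (pos-cancel (pos-resp (value-≈ r (p :* q) eq) z) x)

    split : ∀ p q {r} → Pos r → {reduce r ≈? reduce (p :+ q)} → Pos p ⊎ Pos q
    split p q {r} (positive z) {eq} = Sum.map positive positive
      (pos-split (pos-resp (value-≈ r (p :+ q) eq) z))

    embed : ℕ[n] → Polynomial 2
    embed (nat k) = con (+ k)
    embed 𝕟       = var 0F
    embed (p ⊕ q) = embed p :+ embed q
    embed (p ⊗ q) = embed p :* embed q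

    embed-value : ∀ p → ι (+ evaluate n p) ≈ value (embed p)
    embed-value (nat k) = refl
    embed-value 𝕟       = refl
    embed-value (p ⊕ q) = trans (ι-+ (+ evaluate n p) (+ evaluate n q)) (+-cong (embed-value p) (embed-value q))
    embed-value (p ⊗ q) = trans (reflexive (≡.cong ι (ℤ.pos-* (evaluate n p) (evaluate n q))))
      (trans (ι-* (+ evaluate n p) (+ evaluate n q)) (*-cong (embed-value p) (embed-value q)))

    -- Running digits on vectors

    Triple : Set
    Triple = Elem × Elem × Elem

    _-ᴱ_∙_ : Elem → ℕ[n] → Elem → Elem
    y -ᴱ b ∙ x = y +ᴱ reduce (:- embed b) *ᴱ x

    minus-value : ∀ y b x → ⟦ y -ᴱ b ∙ x ⟧ᴱ ≈ ⟦ y ⟧ᴱ - ι (+ evaluate n b) * ⟦ x ⟧ᴱ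
    minus-value y b x = begin
      ⟦ y +ᴱ reduce (:- embed b) *ᴱ x ⟧ᴱ
        ≈⟨ trans (+ᴱ-homo y _) (+-congˡ (trans (*ᴱ-homo (reduce (:- embed b)) x)
             (*-congʳ (trans (reduce-correct (:- embed b)) (-‿cong (sym (embed-value b))))))) ⟩
      ⟦ y ⟧ᴱ + - ι (+ evaluate n b) * ⟦ x ⟧ᴱ
        ≈⟨ solve 3 (λ y b x → y :+ :- b :* x := y :- b :* x) refl ⟦ y ⟧ᴱ (ι (+ evaluate n b)) ⟦ x ⟧ᴱ ⟩
      ⟦ y ⟧ᴱ - ι (+ evaluate n b) * ⟦ x ⟧ᴱ ∎
      where open ≈-Reasoning setoid

    step : Triple → Digit → Triple
    step (x , y , z) (b , d) = y -ᴱ b ∙ x , z -ᴱ (b ⊕ d) ∙ x , x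

    run : Triple → List Digit → Triple
    run v []       = v
    run v (d ∷ ds) = run (step v d) ds

    Reducedᴱ : Triple → Set
    Reducedᴱ (x , y , z) = Reduced ⟦ x ⟧ᴱ ⟦ y ⟧ᴱ ⟦ z ⟧ᴱ

    Increasingᴱ : Triple → Set
    Increasingᴱ (x , y , _) = Positive (⟦ y ⟧ᴱ - ⟦ x ⟧ᴱ)

    -- Only successors are required to be reduced. The start is exempt because `(1 , |τ| , τ²)`
    -- violates `y < z` as soon as `|τ| < 1`.
    data Steps : Triple → List Digit → Set where
      []  : ∀ {v} → Steps v []
      _∷_ : ∀ {v d ds} → Reducedᴱ (step v d) → Steps (step v d) ds → Steps v (d ∷ ds)

    head : ∀ {v d ds} → Steps v (d ∷ ds) → Reducedᴱ (step v d)
    head (r ∷ _) = r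

    tail : ∀ {v d ds} → Steps v (d ∷ ds) → Steps (step v d) ds
    tail (_ ∷ s) = s

    private
      unstep : ∀ v b d → Reducedᴱ (step v (b , d)) → let (x , y , z) = v in
        Reduced (⟦ y ⟧ᴱ - ι (+ evaluate n b) * ⟦ x ⟧ᴱ)
                (⟦ z ⟧ᴱ - ι (+ (evaluate n b ℕ.+ evaluate n d)) * ⟦ x ⟧ᴱ) ⟦ x ⟧ᴱ
      unstep (x , y , z) b d = reduced-resp (minus-value y b x) (minus-value z (b ⊕ d) x) refl

    increasingᴱ : ∀ v ds → T (leading-positive ds) → Steps v ds → Increasingᴱ v
    increasingᴱ v ((b , d) ∷ ds) b>0 s =
      increasing (evaluate n b) (evaluate n d) (unstep v b d (head s)) (positive?-sound n b b>0)

    reduced-beforeᴱ : ∀ v b d → Reducedᴱ (step v (b , d)) →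
      T (positive? d) ⊎ (T (positive? b) × Increasingᴱ (step v (b , d))) → Reducedᴱ v
    reduced-beforeᴱ (x , y , z) b d r c =
      reduced-before (evaluate n b) (evaluate n d) (unstep (x , y , z) b d r)
        (Sum.map (positive?-sound n d)
          (λ (b>0 , inc) → positive?-sound n b b>0
            , pos-resp (+-cong (minus-value z (b ⊕ d) x) (-‿cong (minus-value y b x))) inc) c)

    -- Reducedness propagates backwards along admissible digits, so it is only needed at the end.
    steps : ∀ ds v d → T (admissible ds) → Reducedᴱ (run v (d ∷ ds)) → Steps v (d ∷ ds)
    steps []             v d _   r = r ∷ []
    steps ((b , e) ∷ ds) v d adm r =
      let c , adm′ = Equivalence.to (T-∧ {positive? e ∨ (positive? b ∧ leading-positive ds)}) adm
          s = steps ds (step v d) (b , e) adm′ r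
          c′ = Sum.map₂ (λ b∧l → let b>0 , l = Equivalence.to (T-∧ {positive? b}) b∧l in
                 b>0 , increasingᴱ (step (step v d) (b , e)) ds l (tail s))
                 (Equivalence.to (T-∨ {positive? e}) c)
      in reduced-beforeᴱ (step v d) b e (head s) c′ ∷ s

    -- Elements as algebraic integers

    integral : ∀ c → Integral ⟦ c ⟧₁
    integral (poly p) = integral-H p
      where
      integral-H : ∀ p → Integral ⟦ poly p ⟧₁
      integral-H ∅              = 0ℤ , ι-0
      integral-H (p *x+ con c)  = integral-+ (integral-* (integral-H p) (+ n , refl)) (c , refl)

    cubic-integer : ∀ {ξ} p q r → ⟦ p ⟧ᴱ ≈ ξ → ⟦ q ⟧ᴱ ≈ τ * ξ → ⟦ r ⟧ᴱ ≈ τ * τ * ξ → CubicInteger ξ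
    cubic-integer {ξ} (a , b , c) (d , e , f) (g , h , i) row₀ row₁ row₂ =
      let k₀ , k₀≈ = integral-neg (det (integral a) (integral b) (integral c)
                       (integral d) (integral e) (integral f) (integral g) (integral h) (integral i))
          k₁ , k₁≈ = integral-+ (integral-+
                       (minor (integral a) (integral e) (integral b) (integral d))
                       (minor (integral a) (integral i) (integral c) (integral g)))
                       (minor (integral e) (integral i) (integral f) (integral h))
          k₂ , k₂≈ = integral-neg (integral-+ (integral-+ (integral a) (integral e)) (integral i))
      in k₀ , k₁ , k₂ , trans
        (+-cong k₀≈ (*-congˡ (+-cong k₁≈ (*-congˡ (+-congʳ k₂≈)))))
        (Characteristic.cayley-hamilton ξ τ (τ * τ)
          ⟦ a ⟧₁ ⟦ b ⟧₁ ⟦ c ⟧₁ ⟦ d ⟧₁ ⟦ e ⟧₁ ⟦ f ⟧₁ ⟦ g ⟧₁ ⟦ h ⟧₁ ⟦ i ⟧₁ row₀ row₁ row₂)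
      where
      minor : ∀ {p q r s} → Integral p → Integral q → Integral r → Integral s → Integral (p * q - r * s)
      minor p q r s = integral-+ (integral-* p q) (integral-neg (integral-* r s))

      det : ∀ {a b c d e f g h i} → Integral a → Integral b → Integral c → Integral d → Integral e →
            Integral f → Integral g → Integral h → Integral i →
            Integral (a * (e * i - f * h) - b * (d * i - f * g) + c * (d * h - e * g))
      det a b c d e f g h i = integral-+
        (integral-+ (integral-* a (minor e i f h)) (integral-neg (integral-* b (minor d i f g))))
        (integral-* c (minor d h e g))

    -- The rows `x`, `τ x`, `τ² x` form the matrix of multiplication by `x` in the basis
    -- `1 , τ , τ²`. Its entries are integers, so its characteristic polynomial is a monic integer
    -- cubic that vanishes at `x`.
    element-integer : ∀ x → CubicInteger ⟦ x ⟧ᴱ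
    element-integer x = cubic-integer x (τ∙ x) (τ∙ (τ∙ x)) refl (τ∙-homo x)
      (trans (τ∙-homo (τ∙ x)) (trans (*-congˡ (τ∙-homo x)) (sym (*-assoc _ _ _))))

    element-∈ℤ[τ] : ∀ x → ℤ[ τ ] ⟦ x ⟧ᴱ
    element-∈ℤ[τ] (c₀ , c₁ , c₂) =
      add (add (coefficient c₀) (mul (coefficient c₁) gen)) (mul (coefficient c₂) (mul gen gen))
      where
      coefficient : ∀ c → ℤ[ τ ] ⟦ c ⟧₁
      coefficient c = let i , i≈c = integral c in resp i≈c (int i)

    -- t is ± τ, and stands for |τ|.
    initial : Polynomial 2 → Triple
    initial t = reduce (con 1ℤ) , reduce t , reduce (var 1F :* var 1F)

    run-++ : ∀ v ds es → run v (ds ++ es) ≡ run (run v ds) es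
    run-++ v []       es = ≡.refl
    run-++ v (d ∷ ds) es = run-++ (step v d) ds es

    steps-++ : ∀ v ds es → Steps v (ds ++ es) → Steps v ds × Steps (run v ds) es
    steps-++ v []       es s       = [] , s
    steps-++ v (d ∷ ds) es (r ∷ s) = let s₁ , s₂ = steps-++ (step v d) ds es s in r ∷ s₁ , s₂

    _≈ᵀ_ : Triple → Triple → Set
    (x , y , z) ≈ᵀ (x′ , y′ , z′) = ⟦ x ⟧ᴱ ≈ ⟦ x′ ⟧ᴱ × ⟦ y ⟧ᴱ ≈ ⟦ y′ ⟧ᴱ × ⟦ z ⟧ᴱ ≈ ⟦ z′ ⟧ᴱ

    _•_ : Elem → Triple → Triple
    ε • (x , y , z) = ε *ᴱ x , ε *ᴱ y , ε *ᴱ z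

    _≈?ᵀ_ : Triple → Triple → Set
    (x , y , z) ≈?ᵀ (x′ , y′ , z′) = x ≈? x′ × y ≈? y′ × z ≈? z′

    ≈?ᵀ-sound : ∀ u v → u ≈?ᵀ v → u ≈ᵀ v
    ≈?ᵀ-sound (x , y , z) (x′ , y′ , z′) (p , q , r) =
      ≈?-sound x x′ p , ≈?-sound y y′ q , ≈?-sound z z′ r

    record PeriodicExpansion (start : Triple) : Set where
      field
        preperiod period : List Digit
        digit            : Digit
        ε η              : Elem
        εη≈1             : ⟦ ε ⟧ᴱ * ⟦ η ⟧ᴱ ≈ 1#
        0<ε              : Positive ⟦ ε ⟧ᴱ
        to-period        : Steps start preperiod
        around           : Steps (run start preperiod) (digit ∷ period)
        returns          : run (run start preperiod) (digit ∷ period) ≈ᵀ (ε • run start preperiod)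

    record PosReduced (x y z : Polynomial 2) : Set where
      constructor reducedᴾ
      field
        0<x : Pos x
        0<y : Pos y
        x<z : Pos (z :- x)
        y<z : Pos (z :- y)

    module _ (start : Triple) (first : Digit) (preperiod : List Digit) (digit : Digit) (period : List Digit)
      (x y z ε η : Polynomial 2) {adm : T (admissible (preperiod ++ digit ∷ period))}
      (0<ε : Pos ε) (red : PosReduced x y z)
      where
      private
        c  = run start (first ∷ preperiod)
        c′ = run c (digit ∷ period)

      -- The backward argument starts at `c′`, which is reduced because it is `ε c`, and ends at the
      -- successor of `start`; hence `first` is left out of `adm`. The polynomials `x , y , z`
      -- present `c` in a form on which reducedness can be certified.
      periodic-expansion :
        {unit : reduce (ε :* η) ≈? reduce (con 1ℤ)} →
        {at-period : c ≈?ᵀ (reduce x , reduce y , reduce z)} →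
        {returns : c′ ≈?ᵀ (reduce ε • c)} →
        PeriodicExpansion start
      periodic-expansion {unit} {at-period} {ret} = record
        { preperiod = first ∷ preperiod ; period = period ; digit = digit
        ; ε = reduce ε ; η = reduce η
        ; εη≈1 = trans (sym (*ᴱ-homo (reduce ε) (reduce η)))
            (trans (≈?-sound (reduce (ε :* η)) (reduce (con 1ℤ)) unit)
              (trans (reduce-correct (con 1ℤ)) ι-1))
        ; 0<ε = 0<ε′
        ; to-period = proj₁ both
        ; around = proj₂ both
        ; returns = c′≈
        }
        where
        0<ε′ = pos-resp (sym (reduce-correct ε)) (value-positive 0<ε)

        c≈ = ≈?ᵀ-sound c (reduce x , reduce y , reduce z) at-period
        c′≈ = ≈?ᵀ-sound c′ (reduce ε • c) ret

        c-reduced : Reducedᴱ c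
        c-reduced = reduced-resp (to x (proj₁ c≈)) (to y (proj₁ (proj₂ c≈))) (to z (proj₂ (proj₂ c≈)))
          (reduced (value-positive (PosReduced.0<x red)) (value-positive (PosReduced.0<y red))
                   (value-positive (PosReduced.x<z red)) (value-positive (PosReduced.y<z red)))
          where
          to : ∀ p {r} → r ≈ ⟦ reduce p ⟧ᴱ → value p ≈ r
          to p e≈ = sym (trans e≈ (reduce-correct p))

        c′-reduced : Reducedᴱ c′
        c′-reduced = reduced-resp
          (back (proj₁ c) (proj₁ c′≈)) (back (proj₁ (proj₂ c)) (proj₁ (proj₂ c′≈)))
          (back (proj₂ (proj₂ c)) (proj₂ (proj₂ c′≈)))
          (reduced-scaled 0<ε′ c-reduced)
          where
          back : ∀ u {r} → r ≈ ⟦ reduce ε *ᴱ u ⟧ᴱ → ⟦ reduce ε ⟧ᴱ * ⟦ u ⟧ᴱ ≈ r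
          back u u′≈ = sym (trans u′≈ (*ᴱ-homo (reduce ε) u))

        both : Steps start (first ∷ preperiod) × Steps c (digit ∷ period)
        both = steps-++ start (first ∷ preperiod) (digit ∷ period)
          (steps (preperiod ++ digit ∷ period) start first adm
            (≡.subst Reducedᴱ (≡.sym (run-++ start (first ∷ preperiod) (digit ∷ period))) c′-reduced))

-- The roots and their partial quotients

module Roots (F : OrderedField) where
  open OrderedFieldProperties F

  𝛕 : Polynomial 2
  𝛕 = var 1F

  private
    𝐧 𝟏 : Polynomial 2
    𝐧 = var 0F
    𝟏 = con 1ℤ

    horner-cong : ∀ {τ p p′ q q′} → p ≈ p′ → q ≈ q′ → ∀ r →
      ι -1ℤ + τ * (p + τ * (q + τ * r)) ≈ ι -1ℤ + τ * (p′ + τ * (q′ + τ * r))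
    horner-cong p≈ q≈ r = +-congˡ (*-congˡ (+-cong p≈ (*-congˡ (+-congʳ q≈))))

    -- The zero constant of the solver is `ι 0ℤ`, whereas Horner evaluation ends in `0#`.
    leading : ∀ τ → ι 1ℤ + τ * ι 0ℤ ≈ ι 1ℤ + τ * 0#
    leading τ = +-congˡ (*-congˡ ι-0)

    plus-1 : ∀ {x} → x ≈ 0# → x + ι 1ℤ ≈ 1#
    plus-1 x≈0 = trans (+-cong x≈0 ι-1) (+-identityˡ 1#)

    ι-a : ∀ n k → ι (+ n) + ι (+ k) ≈ ι (+ (k ℕ.+ n))
    ι-a n k = trans (+-comm _ _) (sym (ι-+ (+ k) (+ n)))

  root₁ : ∀ n τ → let a = + (3 ℕ.+ n) in
    ι -1ℤ + τ * (ι (ℤ.- a) + τ * (ι (a ℤ.- 1ℤ) + τ * (ι 1ℤ + τ * 0#))) ≈ 0# →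
    (τ + (ι (+ n) + ι (+ 3))) * τ * (τ - ι 1ℤ) ≈ 1#
  root₁ n τ p≈0 = begin
    (τ + A) * τ * (τ - ι 1ℤ)
      ≈⟨ solve 2 (λ t a → (t :+ a) :* t :* (t :- con 1ℤ) :=
           con -1ℤ :+ t :* (:- a :+ t :* ((a :+ con -1ℤ) :+ t :* (con 1ℤ :+ t :* con 0ℤ))) :+ con 1ℤ) refl τ A ⟩
    ι -1ℤ + τ * (- A + τ * ((A + ι -1ℤ) + τ * (ι 1ℤ + τ * ι 0ℤ))) + ι 1ℤ
      ≈⟨ +-congʳ (+-congˡ (*-congˡ (+-congˡ (*-congˡ (+-congˡ (*-congˡ (leading τ))))))) ⟩
    ι -1ℤ + τ * (- A + τ * ((A + ι -1ℤ) + τ * (ι 1ℤ + τ * 0#))) + ι 1ℤ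
      ≈⟨ +-congʳ (horner-cong (trans (-‿cong (ι-a n 3)) (sym (ι-neg a)))
           (trans (+-congʳ (ι-a n 3)) (sym (ι-+ a -1ℤ))) _) ⟩
    ι -1ℤ + τ * (ι (ℤ.- a) + τ * (ι (a ℤ.- 1ℤ) + τ * (ι 1ℤ + τ * 0#))) + ι 1ℤ
      ≈⟨ plus-1 p≈0 ⟩
    1# ∎
    where
    open ≈-Reasoning setoid
    a = + (3 ℕ.+ n)
    A = ι (+ n) + ι (+ 3)

  root₂ : ∀ n τ → let a = + (5 ℕ.+ n) in
    ι -1ℤ + τ * (ι (ℤ.- a) + τ * (ι (ℤ.- (a ℤ.- 1ℤ)) + τ * (ι 1ℤ + τ * 0#))) ≈ 0# →
    (τ + ι 1ℤ) * τ * (τ - (ι (+ n) + ι (+ 5))) ≈ 1#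
  root₂ n τ p≈0 = begin
    (τ + ι 1ℤ) * τ * (τ - A)
      ≈⟨ solve 2 (λ t a → (t :+ con 1ℤ) :* t :* (t :- a) :=
           con -1ℤ :+ t :* (:- a :+ t :* (:- (a :+ con -1ℤ) :+ t :* (con 1ℤ :+ t :* con 0ℤ))) :+ con 1ℤ) refl τ A ⟩
    ι -1ℤ + τ * (- A + τ * (- (A + ι -1ℤ) + τ * (ι 1ℤ + τ * ι 0ℤ))) + ι 1ℤ
      ≈⟨ +-congʳ (+-congˡ (*-congˡ (+-congˡ (*-congˡ (+-congˡ (*-congˡ (leading τ))))))) ⟩
    ι -1ℤ + τ * (- A + τ * (- (A + ι -1ℤ) + τ * (ι 1ℤ + τ * 0#))) + ι 1ℤ
      ≈⟨ +-congʳ (horner-cong (trans (-‿cong (ι-a n 5)) (sym (ι-neg a)))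
           (trans (-‿cong (trans (+-congʳ (ι-a n 5)) (sym (ι-+ a -1ℤ)))) (sym (ι-neg (a ℤ.- 1ℤ)))) _) ⟩
    ι -1ℤ + τ * (ι (ℤ.- a) + τ * (ι (ℤ.- (a ℤ.- 1ℤ)) + τ * (ι 1ℤ + τ * 0#))) + ι 1ℤ
      ≈⟨ plus-1 p≈0 ⟩
    1# ∎
    where
    open ≈-Reasoning setoid
    a = + (5 ℕ.+ n)
    A = ι (+ n) + ι (+ 5)

  -- The partial quotients were read off numerical expansions; n = a - 3, and n = a - 5 in Root₂.
  module Root₁ (n : ℕ) (τ : Carrier)
    (root : (τ + (ι (+ n) + ι (+ 3))) * τ * (τ - ι 1ℤ) ≈ 1#) where

    v w : Polynomial 1
    v = var 0F :+ con (+ 3)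
    w = :- (var 0F :+ con (+ 2))

    cubic : τ * (τ * τ) ≈ 1# + ⟦ v ⟧ (ι (+ n) ∷ []) * τ + ⟦ w ⟧ (ι (+ n) ∷ []) * (τ * τ)
    cubic = trans
      (solve 2 (λ n t →
         t :* (t :* t) := (t :+ (n :+ con (+ 3))) :* t :* (t :- con 1ℤ)
           :+ (n :+ con (+ 3)) :* t :+ (:- (n :+ con (+ 2))) :* (t :* t))
         refl (ι (+ n)) τ)
      (+-congʳ (+-congʳ root))

    open CubicOrder n τ v w cubic public

    private
      a t : Polynomial 2
      a = 𝐧 :+ con (+ 3)
      t = :- 𝛕

      0<a : Pos a
      0<a = n⊞ lit 2

    -- The unit relation is `u τ (τ + a) = 1`. Its cube splits into `ε = u³ (τ + a)` and
    -- `η = τ³ (τ + a)²`.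
    above-1 : Pos (𝛕 :- 𝟏) → PeriodicExpansion (initial 𝛕)
    above-1 0<u = periodic-expansion (initial 𝛕)
      (nat 1 , nat 0) ((nat 2 , nat 3 ⊕ 𝕟) ∷ [])
      (nat 0 , nat 5 ⊕ 𝕟) ((nat 0 , nat 6 ⊕ 𝕟) ∷ [])
      (u :* u) (u :* (u :* u :* u :* (𝛕 :+ a))) u
      (u :* u :* u :* (𝛕 :+ a)) η 0<ε red
      where
      u η : Polynomial 2
      u = 𝛕 :- 𝟏
      η = 𝛕 :* (𝛕 :* (𝛕 :+ a)) :* (𝛕 :* (𝛕 :+ a))

      0<τ : Pos 𝛕
      0<τ = rewritten (0<u ⊞ lit 0)

      0<1-u : Pos (𝟏 :- u)
      0<1-u = rewritten (0<u ⊠ (0<τ ⊠ 0<a ⊞ 0<u ⊠ (0<τ ⊞ lit 0)))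

      0<ε : Pos (u :* u :* u :* (𝛕 :+ a))
      0<ε = 0<u ⊠ 0<u ⊠ 0<u ⊠ (0<τ ⊞ 0<a)

      red : PosReduced (u :* u) (u :* (u :* u :* u :* (𝛕 :+ a))) u
      red = reducedᴾ (0<u ⊠ 0<u) (0<u ⊠ 0<ε) (rewritten (0<u ⊠ 0<1-u))
        -- Since `τ (1 - ε) = τ - u² = 1 + u (1 - u)` and `u (τ + a)` is the inverse of `τ`.
        (rewritten (0<u ⊠ (0<u ⊠ (0<τ ⊞ 0<a)) ⊠ (lit 0 ⊞ 0<u ⊠ 0<1-u)))

    above-neg-1 : Pos t → Pos (𝟏 :- t) → PeriodicExpansion (initial (:- 𝛕))
    above-neg-1 0<t t<1 = periodic-expansion (initial (:- 𝛕))
      (nat 0 , nat 0)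
      ((nat 0 , nat 3 ⊕ 𝕟) ∷ (nat 1 ⊕ 𝕟 , nat 2) ∷ (nat 0 , nat 1) ∷ (nat 0 , nat 1) ∷ [])
      (nat 0 , nat 1 ⊕ 𝕟)
      ((nat 0 , nat 1) ∷ (nat 0 , nat 1) ∷ (nat 0 , nat 3 ⊕ 𝕟) ∷ (𝕟 , nat 3) ∷ (nat 0 , nat 1) ∷ (nat 0 , nat 1) ∷ [])
      (t :* t :* t) (t :* t :* t :* y) (t :* t :* t :* (a :- 𝟏 :- t))
      (t :* t :* t :* y) η 0<ε red
      where
      η y : Polynomial 2
      y = t :* (a :- t)
      η = (𝟏 :+ t) :* ((𝟏 :+ t) :* (a :- t)) :* ((𝟏 :+ t) :* (a :- t)) :* ((𝟏 :+ t) :* (a :- t))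

      0<a-t : Pos (a :- t)
      0<a-t = rewritten (n⊞ (lit 1 ⊞ t<1))

      0<t³ : Pos (t :* t :* t)
      0<t³ = 0<t ⊠ 0<t ⊠ 0<t

      0<ε : Pos (t :* t :* t :* y)
      0<ε = 0<t³ ⊠ (0<t ⊠ 0<a-t)

      red : PosReduced (t :* t :* t) (t :* t :* t :* y) (t :* t :* t :* (a :- 𝟏 :- t))
      red = reducedᴾ 0<t³ 0<ε (rewritten (0<t³ ⊠ (n⊞ t<1)))
        -- The last summand is `1 - y = t y`, because `(1 + t) y = 1`.
        (rewritten (0<t³ ⊠ ((n⊞ t<1) ⊞ 0<t ⊠ (0<t ⊠ 0<a-t))))

    -- Here `t = a - s` with `s` small, so the floors of `t` and `t²` are `a - 1` and `a² - 1`, and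
    -- this first step already reaches the periodic vector. The unit relation reads
    -- `s t (1 + t) = 1`.
    below-neg-1 : Pos (𝛕 :+ a) → Pos t → Pos (con (+ 4) :* t :- con (+ 3)) → PeriodicExpansion (initial (:- 𝛕))
    below-neg-1 0<s 0<t 3<4t = periodic-expansion (initial (:- 𝛕))
      (nat 2 ⊕ 𝕟 , (nat 3 ⊕ 𝕟) ⊗ (nat 2 ⊕ 𝕟)) []
      (nat 0 , nat 1) ((nat 0 , nat 1) ∷ (nat 4 ⊕ nat 2 ⊗ 𝕟 , nat 1 ⊕ nat 3 ⊗ 𝕟 ⊕ 𝕟 ⊗ 𝕟) ∷ [])
      (𝟏 :- s) (𝟏 :- con (+ 2) :* a :* s :+ s :* s) 𝟏
      s (t :* (𝟏 :+ t)) 0<s red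
      where
      s : Polynomial 2
      s = 𝛕 :+ a

      s<1 : Pos (𝟏 :- s)
      -- The cofactor of `s` is `16 (t² + t - 1)`. It is positive because 3/4 exceeds the positive
      -- zero `(√5 - 1) / 2` of `t² + t - 1`.
      s<1 = divided (con (+ 16))
        (0<s ⊠ (3<4t ⊠ (lit 3 ⊠ 0<t ⊞ lit 6) ⊞ lit 4)) (lit 15)

      red : PosReduced (𝟏 :- s) (𝟏 :- con (+ 2) :* a :* s :+ s :* s) 𝟏
      red = reducedᴾ s<1
        (rewritten (0<s ⊠ (0<a ⊠ ((n⊞ s<1) ⊞ s<1) ⊞ 0<s ⊠ 0<s)))
        (rewritten 0<s) (rewritten (0<s ⊠ (0<a ⊞ 0<t)))

    expansion : (Positive τ × PeriodicExpansion (initial 𝛕)) ⊎ (Positive (- τ) × PeriodicExpansion (initial (:- 𝛕)))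
    expansion = by-sign (signs-of-product root (value-positive τ<τ+a) (value-positive τ-1<τ))
      where
      τ<τ+a : Pos ((𝛕 :+ a) :- 𝛕)
      τ<τ+a = rewritten 0<a

      τ-1<τ : Pos (𝛕 :- (𝛕 :- 𝟏))
      τ-1<τ = rewritten (lit 0)

      0<τ : Pos (𝛕 :- 𝟏) → Pos 𝛕
      0<τ 0<u = rewritten (0<u ⊞ lit 0)

      by-size : Pos (𝛕 :+ a) → Pos t → Pos (con (+ 4) :* t :- con (+ 3)) ⊎ Pos (con (+ 4) :* (𝟏 :- t)) →
                PeriodicExpansion (initial (:- 𝛕))
      by-size 0<s 0<t (inj₁ 3<4t) = below-neg-1 0<s 0<t 3<4t
      by-size 0<s 0<t (inj₂ t<1)  = above-neg-1 0<t (divided (con (+ 4)) t<1 (lit 3))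

      by-sign : Positive (τ - ι 1ℤ) ⊎ (Positive (τ + (ι (+ n) + ι (+ 3))) × Positive (- τ)) →
                (Positive τ × PeriodicExpansion (initial 𝛕)) ⊎ (Positive (- τ) × PeriodicExpansion (initial (:- 𝛕)))
      by-sign (inj₁ 0<u)         = inj₁ (value-positive (0<τ (positive 0<u)) , above-1 (positive 0<u))
      by-sign (inj₂ (0<s , τ<0)) = inj₂ (τ<0 , by-size (positive 0<s) (positive τ<0)
        -- The two quantities add up to 1; the cases `3/4 < t` and `t < 1` overlap.
        (split (con (+ 4) :* t :- con (+ 3)) (con (+ 4) :* (𝟏 :- t)) (lit 0)))

  module Root₂ (n : ℕ) (τ : Carrier)
    (root : (τ + ι 1ℤ) * τ * (τ - (ι (+ n) + ι (+ 5))) ≈ 1#) where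

    v w : Polynomial 1
    v = var 0F :+ con (+ 5)
    w = var 0F :+ con (+ 4)

    cubic : τ * (τ * τ) ≈ 1# + ⟦ v ⟧ (ι (+ n) ∷ []) * τ + ⟦ w ⟧ (ι (+ n) ∷ []) * (τ * τ)
    cubic = trans
      (solve 2 (λ n t →
         t :* (t :* t) := (t :+ con 1ℤ) :* t :* (t :- (n :+ con (+ 5)))
           :+ (n :+ con (+ 5)) :* t :+ (n :+ con (+ 4)) :* (t :* t))
         refl (ι (+ n)) τ)
      (+-congʳ (+-congʳ root))

    open CubicOrder n τ v w cubic public

    private
      a t s : Polynomial 2
      a = 𝐧 :+ con (+ 5)
      t = :- 𝛕
      s = 𝟏 :+ 𝛕

      0<a : Pos a
      0<a = n⊞ lit 4

    -- As `1 / δ = τ (τ + 1)`, dividing the coordinates of `c` by `δ²` gives `1`, `τ + a + 1` and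
    -- `τ (τ + 1)`. The floors `2a + 1` and `a² + a` form the only digit of the period, and that
    -- step multiplies `c` by `δ`.
    above-a : Pos (𝛕 :- a) → PeriodicExpansion (initial 𝛕)
    above-a 0<δ = periodic-expansion (initial 𝛕)
      (nat 5 ⊕ 𝕟 , (nat 5 ⊕ 𝕟) ⊗ (nat 4 ⊕ 𝕟)) ((nat 10 ⊕ nat 2 ⊗ 𝕟 , (nat 5 ⊕ 𝕟) ⊗ (nat 4 ⊕ 𝕟)) ∷ [])
      (nat 11 ⊕ nat 2 ⊗ 𝕟 , nat 19 ⊕ nat 9 ⊗ 𝕟 ⊕ 𝕟 ⊗ 𝕟) []
      (δ :* δ) (𝟏 :- (a :* a :+ a) :* δ) δ
      δ (𝛕 :* (𝛕 :+ 𝟏)) 0<δ red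
      where
      δ : Polynomial 2
      δ = 𝛕 :- a

      0<τ : Pos 𝛕
      0<τ = rewritten (0<δ ⊞ 0<a)

      δ<1 : Pos (𝟏 :- δ)
      δ<1 = rewritten (0<δ ⊠ (0<τ ⊠ 0<τ ⊞ (0<δ ⊞ (n⊞ lit 3))))

      red : PosReduced (δ :* δ) (𝟏 :- (a :* a :+ a) :* δ) δ
      red = reducedᴾ (0<δ ⊠ 0<δ)
        (rewritten (0<δ ⊠ 0<δ ⊠ (0<δ ⊞ lit 1 ⊠ 0<a ⊞ lit 0)))
        (rewritten (0<δ ⊠ δ<1))
        -- The difference is `δ² (τ² - a - 1)`, where `τ² = δ τ + a δ + a²`. With `M = a - 4` the
        -- rest `a² - a - 1` equals `M (M + 7) + 11`.
        (rewritten (0<δ ⊠ 0<δ ⊠ (0<δ ⊠ 0<τ ⊞ 0<a ⊠ 0<δ ⊞ 0<M ⊠ (0<M ⊞ lit 6) ⊞ lit 10)))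
        where
        0<M : Pos (𝐧 :+ 𝟏)
        0<M = n⊞ lit 0

    near-0 : Pos t → Pos s → Pos (con (+ 3) :- con (+ 5) :* t) → PeriodicExpansion (initial (:- 𝛕))
    near-0 0<t 0<s t<3/5 = periodic-expansion (initial (:- 𝛕))
      (nat 0 , nat 0) ((nat 0 , nat 3 ⊕ 𝕟) ∷ (nat 3 ⊕ 𝕟 , nat 0) ∷ [])
      (nat 1 , nat 0) ((nat 1 , 𝕟) ∷ (nat 2 ⊕ 𝕟 , nat 1) ∷ [])
      (t :* t :* (𝟏 :- t :* y :* (𝟏 :+ t))) (t :* t :* (𝟏 :- t :* t :* y)) (t :* t)
      (t :* t :* y) (s :* (s :* (a :+ t)) :* (s :* (a :+ t))) 0<ε red
      where
      y : Polynomial 2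
      y = t :* (a :+ t)

      0<y : Pos y
      0<y = 0<t ⊠ (0<a ⊞ 0<t)

      0<ε : Pos (t :* t :* y)
      0<ε = 0<t ⊠ 0<t ⊠ 0<y

      -- 1 = x (1 - x) (a + t) > 5 x (1 - x) turns x < m / k into x < k / 5 (k - m), for x = t here
      -- and for x = s in near-neg-1.
      t<1/2 : Pos (𝟏 :- con (+ 2) :* t)
      t<1/2 = rewritten (0<t ⊠ (0<s ⊠ (n⊞ 0<t) ⊞ t<3/5))

      t<2/5 : Pos (con (+ 2) :- con (+ 5) :* t)
      t<2/5 = rewritten (0<t ⊠ (lit 1 ⊠ 0<s ⊠ (n⊞ 0<t) ⊞ lit 4 ⊠ t<1/2))

      -- The first coordinate of `c` is `t² y` times this, by `1 = (1 - t) y`. The bound 2/5 lies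
      -- just below its zero `√2 - 1`.
      0<1-2t-t² : Pos (𝟏 :- con (+ 2) :* t :- t :* t)
      0<1-2t-t² = divided (con (+ 25)) (t<2/5 ⊠ (lit 11 ⊞ lit 4 ⊠ 0<t) ⊞ lit 0) (lit 24)

      red : PosReduced (t :* t :* (𝟏 :- t :* y :* (𝟏 :+ t))) (t :* t :* (𝟏 :- t :* t :* y)) (t :* t)
      red = reducedᴾ
        (rewritten (0<t ⊠ 0<t ⊠ 0<y ⊠ 0<1-2t-t²))
        (rewritten (0<t ⊠ 0<t ⊠ 0<y ⊠ (0<t ⊞ 0<1-2t-t²)))
        (rewritten (0<t ⊠ 0<t ⊠ (0<t ⊠ 0<y ⊠ (lit 0 ⊞ 0<t))))
        (rewritten (0<t ⊠ 0<t ⊠ 0<ε))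

    near-neg-1 : Pos t → Pos s → Pos (𝟏 :- con (+ 2) :* s) → PeriodicExpansion (initial (:- 𝛕))
    near-neg-1 0<t 0<s s<1/2 = periodic-expansion (initial (:- 𝛕))
      (nat 0 , nat 0)
      ((nat 0 , nat 1) ∷ (nat 0 , nat 1) ∷ (nat 0 , nat 2 ⊕ 𝕟) ∷ (nat 0 , nat 1) ∷ (nat 0 , nat 1) ∷ [])
      (nat 0 , nat 3 ⊕ 𝕟)
      ((𝕟 , nat 3) ∷ (nat 0 , nat 1) ∷ (nat 0 , nat 1) ∷ (nat 0 , nat 1 ⊕ 𝕟) ∷ (nat 0 , nat 1) ∷ (nat 0 , nat 1) ∷ [])
      (s :* s) (s :* s :* s :* (s :* z)) (𝟏 :- (a :- 𝟏) :* s :+ s :* s)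
      (s :* s :* s :* (s :* z) :* (s :* z)) (t :* t :* (t :* z) :* (t :* z) :* (t :* z)) 0<ε red
      where
      z : Polynomial 2
      z = a :+ t

      0<z : Pos z
      0<z = 0<a ⊞ 0<t

      0<ε : Pos (s :* s :* s :* (s :* z) :* (s :* z))
      0<ε = 0<s ⊠ 0<s ⊠ 0<s ⊠ (0<s ⊠ 0<z) ⊠ (0<s ⊠ 0<z)

      s<2/5 : Pos (con (+ 2) :- con (+ 5) :* s)
      s<2/5 = rewritten (0<s ⊠ (lit 1 ⊠ 0<t ⊠ (n⊞ 0<t) ⊞ lit 4 ⊠ s<1/2))

      s<1/3 : Pos (𝟏 :- con (+ 3) :* s)
      s<1/3 = rewritten (0<s ⊠ (0<t ⊠ (n⊞ 0<t) ⊞ s<2/5))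

      -- Substituting `1 = s t z` twice turns `1 - (a - 1) s` into `s²` times this polynomial.
      -- Tripled, it is `(1 - 3 s) (2 a + 3) + (a - 3) + 6 s²`.
      0<q : Pos (a :- (con (+ 2) :* a :+ con (+ 3)) :* s :+ con (+ 2) :* s :* s)
      0<q = divided (con (+ 3))
        (s<1/3 ⊠ (lit 1 ⊠ 0<a ⊞ lit 2) ⊞ (n⊞ lit 1) ⊞ lit 5 ⊠ 0<s ⊠ 0<s) (lit 2)

      x<z : Pos ((𝟏 :- (a :- 𝟏) :* s :+ s :* s) :- s :* s)
      x<z = rewritten (0<s ⊠ 0<s ⊠ 0<q)

      red : PosReduced (s :* s) (s :* s :* s :* (s :* z)) (𝟏 :- (a :- 𝟏) :* s :+ s :* s)
      red = reducedᴾ (0<s ⊠ 0<s) (0<s ⊠ 0<s ⊠ 0<s ⊠ (0<s ⊠ 0<z)) x<z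
        -- The second summand is the first coordinate minus the second:
        -- `1 - s (s z) = (t - s) (s z)` with `t - s = 1 - 2 s`.
        (rewritten (x<z ⊞ 0<s ⊠ 0<s ⊠ (0<s ⊠ 0<z) ⊠ s<1/2))

    expansion : (Positive τ × PeriodicExpansion (initial 𝛕)) ⊎ (Positive (- τ) × PeriodicExpansion (initial (:- 𝛕)))
    expansion = by-sign (signs-of-product root (value-positive τ<τ+1) (value-positive τ-a<τ))
      where
      τ<τ+1 : Pos ((𝛕 :+ 𝟏) :- 𝛕)
      τ<τ+1 = rewritten (lit 0)

      τ-a<τ : Pos (𝛕 :- (𝛕 :- a))
      τ-a<τ = rewritten 0<a

      0<τ : Pos (𝛕 :- a) → Pos 𝛕
      0<τ 0<δ = rewritten (0<δ ⊞ 0<a)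

      0<s : Pos (𝛕 :+ 𝟏) → Pos s
      0<s 0<τ+1 = rewritten 0<τ+1

      by-size : Pos t → Pos s →
                Pos (con (+ 2) :* (con (+ 3) :- con (+ 5) :* t)) ⊎ Pos (con (+ 5) :* (𝟏 :- con (+ 2) :* s)) →
                PeriodicExpansion (initial (:- 𝛕))
      by-size 0<t 0<s (inj₁ t<3/5) = near-0 0<t 0<s (divided (con (+ 2)) t<3/5 (lit 1))
      by-size 0<t 0<s (inj₂ s<1/2) = near-neg-1 0<t 0<s (divided (con (+ 5)) s<1/2 (lit 4))

      by-sign : Positive (τ - (ι (+ n) + ι (+ 5))) ⊎ (Positive (τ + ι 1ℤ) × Positive (- τ)) →
                (Positive τ × PeriodicExpansion (initial 𝛕)) ⊎ (Positive (- τ) × PeriodicExpansion (initial (:- 𝛕)))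
      by-sign (inj₁ 0<δ)           = inj₁ (value-positive (0<τ (positive 0<δ)) , above-a (positive 0<δ))
      by-sign (inj₂ (0<τ+1 , τ<0)) = inj₂ (τ<0 , by-size (positive τ<0) (0<s (positive 0<τ+1))
        -- Because `t + s = 1` the two quantities add up to 1; the cases `t < 3/5` and `1/2 < t`
        -- overlap.
        (split (con (+ 2) :* (con (+ 3) :- con (+ 5) :* t)) (con (+ 5) :* (𝟏 :- con (+ 2) :* s)) (lit 0)))

-- Expansions over an ordered field

module JacobiPerron (F : OrderedField) where
  open OrderedFieldProperties F

  infix 4 _≋_

  _≋_ : Vector Carrier 3 → Vector Carrier 3 → Set
  u ≋ v = ∀ i → u i ≈ v i

  vector : Carrier → Carrier → Carrier → Vector Carrier 3
  vector x y z 0F = x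
  vector x y z 1F = y
  vector x y z 2F = z

  record Step (β β′ : Vector Carrier 3) : Set where
    constructor mkStep
    field
      {β₁⁻¹} : Carrier
      b c    : ℤ
      isInverse : β 0F * β₁⁻¹ ≈ 1#
      floor-b   : Floor (β 1F * β₁⁻¹) b
      floor-c   : Floor (β 2F * β₁⁻¹) c
      next₀     : β′ 0F ≈ β 1F - ι b * β 0F
      next₁     : β′ 1F ≈ β 2F - ι c * β 0F
      next₂     : β′ 2F ≈ β 0F

  Steps∞ : (ℕ → Vector Carrier 3) → Set
  Steps∞ β = ∀ k → Step (β k) (β (suc k))

  record Periodic (τ : Carrier) (v : Vector Carrier 3) : Set where
    field
      ε η       : Carrier
      ε-integer : CubicInteger ε
      η-integer : CubicInteger η
      ε∈ℤ[τ]    : ℤ[ τ ] ε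
      η∈ℤ[τ]    : ℤ[ τ ] η
      εη≈1      : ε * η ≈ 1#
      exists    : ∃[ β ] (β 0 ≋ v × Steps∞ β)
      periodic  : ∀ β → β 0 ≋ v → Steps∞ β →
        ∃[ l₀ ] ∃[ l ] (∀ i k → l₀ ℕ.≤ k → β (k ℕ.+ suc l) i ≈ ε * β k i)

  step-resp : ∀ {β γ β′} → β ≋ γ → Step γ β′ → Step β β′
  step-resp β≋γ (mkStep b c inverse floor-b floor-c n₀ n₁ n₂) = mkStep b c
    (trans (*-congʳ (β≋γ 0F)) inverse)
    (floor-resp (*-congʳ (sym (β≋γ 1F))) floor-b) (floor-resp (*-congʳ (sym (β≋γ 2F))) floor-c)
    (trans n₀ (+-cong (sym (β≋γ 1F)) (-‿cong (*-congˡ (sym (β≋γ 0F))))))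
    (trans n₁ (+-cong (sym (β≋γ 2F)) (-‿cong (*-congˡ (sym (β≋γ 0F))))))
    (trans n₂ (sym (β≋γ 0F)))

  -- Quotients of coordinates are unchanged by scaling, so both steps take the same floors. With
  -- factor 1 this is uniqueness of the expansion, as `arrive` uses it.
  step-scaled : ∀ {ε β β′ γ γ′} → Step β β′ → Step γ γ′ →
                (∀ i → γ i ≈ ε * β i) → ∀ i → γ′ i ≈ ε * β′ i
  step-scaled {ε} {β} {β′} {γ} {γ′} s t γ≈ = λ where
      0F → trans T.next₀ (trans
        (same S.b T.b 1F (floor-unique (quotients-≈ 1F) S.floor-b T.floor-b)) (*-congˡ (sym S.next₀)))
      1F → trans T.next₁ (trans
        (same S.c T.c 2F (floor-unique (quotients-≈ 2F) S.floor-c T.floor-c)) (*-congˡ (sym S.next₁)))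
      2F → trans T.next₂ (trans (γ≈ 0F) (*-congˡ (sym S.next₂)))
    where
    module S = Step s
    module T = Step t

    quotients-≈ : ∀ i → β i * S.β₁⁻¹ ≈ γ i * T.β₁⁻¹
    quotients-≈ i = quotient-scaled (γ≈ 0F) (γ≈ i) S.isInverse T.isInverse

    same : ∀ b c i → b ≡ c → γ i - ι c * γ 0F ≈ ε * (β i - ι b * β 0F)
    same b .b i ≡.refl = difference-scaled (ι b) (γ≈ 0F) (γ≈ i)

  step-reduced : ∀ {β β′} b c → β′ 0F ≈ β 1F - ι b * β 0F → β′ 1F ≈ β 2F - ι c * β 0F → β′ 2F ≈ β 0F →
                 Reduced (β′ 0F) (β′ 1F) (β′ 2F) → Step β β′
  step-reduced {β} {β′} b c n₀ n₁ n₂ (reduced 0<x 0<y x<z y<z) =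
    mkStep b c i (floor 1F b n₀ 0<x x<z) (floor 2F c n₁ 0<y y<z) n₀ n₁ n₂
    where
    0<β₁ : Positive (β 0F)
    0<β₁ = pos-resp (trans (solve 2 (λ x z → x :+ (z :- x) := z) refl (β′ 0F) (β′ 2F)) n₂)
             (pos-+ 0<x x<z)
    i = proj₂ (inverse 0<β₁)

    floor : ∀ j b {r} → r ≈ β j - ι b * β 0F → Positive r → Positive (β′ 2F - r) →
            Floor (β j * proj₁ (inverse 0<β₁)) b
    floor j b r≈ 0<r r<z = floor-quotient b
      (trans (*-assoc _ _ _) (trans (*-congˡ (trans (*-comm _ _) i)) (*-identityʳ _)))
      0<β₁ (pos-resp r≈ 0<r) (pos-resp (+-cong n₂ (-‿cong r≈)) r<z)

  data Path (w : Vector Carrier 3) : ℕ → Vector Carrier 3 → Set where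
    done : ∀ {u} → u ≋ w → Path w 0 u
    _∷_  : ∀ {k u u′} → Step u u′ → Path w k u′ → Path w (suc k) u

  path-resp : ∀ {w w′ k u} → w ≋ w′ → Path w k u → Path w′ k u
  path-resp w≋w′ (done u≋w) = done (λ i → trans (u≋w i) (w≋w′ i))
  path-resp w≋w′ (s ∷ p)    = s ∷ path-resp w≋w′ p

  arrive : ∀ {w k u} → Path w k u → ∀ β → Steps∞ β → β 0 ≋ u → β k ≋ w
  arrive (done u≋w) β _     β₀≋u i = trans (β₀≋u i) (u≋w i)
  arrive (s ∷ p)    β steps β₀≋u   = arrive p (λ k → β (suc k)) (λ k → steps (suc k))
    (λ i → trans (step-scaled s (steps 0) (λ j → trans (β₀≋u j) (sym (*-identityˡ _))) i) (*-identityˡ _))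

  scaled-forever : ∀ {ε} β → Steps∞ β → ∀ l m → (∀ i → β (m ℕ.+ l) i ≈ ε * β m i) →
                   ∀ j i → β (j ℕ.+ m ℕ.+ l) i ≈ ε * β (j ℕ.+ m) i
  scaled-forever β steps l m base zero    = base
  scaled-forever β steps l m base (suc j) =
    step-scaled (steps (j ℕ.+ m)) (steps (j ℕ.+ m ℕ.+ l)) (scaled-forever β steps l m base j)

  infixr 6 _⊙_

  _⊙_ : Carrier → Vector Carrier 3 → Vector Carrier 3
  (s ⊙ u) i = s * u i

  module FromCycle {ε : Carrier} {v : Vector Carrier 3} {l : ℕ} (0<ε : Positive ε)
    (cycle : ∀ {s} → Positive s → Path (s * ε ⊙ v) (suc l) (s ⊙ v)) where

    -- A position within a lap around the cycle: `s` is the factor accumulated in earlier laps, and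
    -- the path is what remains before `s ⊙ v` is met again.
    State : Set
    State = Σ (Vector Carrier 3) λ u → ∃[ s ] (Positive s × ∃[ k ] Path (s ⊙ v) k u)

    advance : (S : State) → Σ State λ S′ → Step (proj₁ S) (proj₁ S′)
    advance (u , s , 0<s , suc k , t ∷ p)      = (_ , s , 0<s , k , p) , t
    -- The next lap starts with factor `s * ε`. Its length is a successor, so it does provide a
    -- step.
    advance (u , s , 0<s , zero , done u≋sv) with t ∷ p ← cycle 0<s =
      (_ , s * ε , pos-* 0<s 0<ε , l , p) , step-resp u≋sv t

    orbit : State → ℕ → State
    orbit S zero    = S
    orbit S (suc k) = proj₁ (advance (orbit S k))

    iterates : State → ℕ → Vector Carrier 3
    iterates S k = proj₁ (orbit S k)

    iterates-steps : ∀ S → Steps∞ (iterates S)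
    iterates-steps S k = proj₂ (advance (orbit S k))

  module Cubic (n : ℕ) (τ : Carrier) (v w : Polynomial 1)
    (cubic : τ * (τ * τ) ≈ 1# + ⟦ v ⟧ (ι (+ n) ∷ []) * τ + ⟦ w ⟧ (ι (+ n) ∷ []) * (τ * τ)) where
    open CubicOrder n τ v w cubic

    ⟦_⟧ᵀ : Triple → Vector Carrier 3
    ⟦ x , y , z ⟧ᵀ = vector ⟦ x ⟧ᴱ ⟦ y ⟧ᴱ ⟦ z ⟧ᴱ

    path : ∀ {s v ds} → Positive s → Steps v ds → Path (s ⊙ ⟦ run v ds ⟧ᵀ) (length ds) (s ⊙ ⟦ v ⟧ᵀ)
    path 0<s [] = done (λ _ → refl)
    path {s} {x , y , z} 0<s (_∷_ {d = b , d} r steps) =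
      step-reduced (+ evaluate n b) (+ evaluate n (b ⊕ d))
        (scaled-minus y b) (scaled-minus z (b ⊕ d)) refl (reduced-scaled 0<s r) ∷ path 0<s steps
      where
      scaled-minus : ∀ y b → s * ⟦ y -ᴱ b ∙ x ⟧ᴱ ≈ s * ⟦ y ⟧ᴱ - ι (+ evaluate n b) * (s * ⟦ x ⟧ᴱ)
      scaled-minus y b = trans (*-congˡ (minus-value y b x))
        (sym (difference-scaled (ι (+ evaluate n b)) refl refl))

    module _ {start : Triple} (E : PeriodicExpansion start) where
      open PeriodicExpansion E

      private
        c : Triple
        c = run start preperiod

        1⊙ : ∀ u → 1# ⊙ u ≋ u
        1⊙ u i = *-identityˡ (u i)

        0<1 : Positive 1#
        0<1 = pos-resp ι-1 (pos-ι 0)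

        returns-≋ : ∀ s → s ⊙ ⟦ run c (digit ∷ period) ⟧ᵀ ≋ s * ⟦ ε ⟧ᴱ ⊙ ⟦ c ⟧ᵀ
        returns-≋ s = λ where
            0F → component (proj₁ c) (proj₁ returns)
            1F → component (proj₁ (proj₂ c)) (proj₁ (proj₂ returns))
            2F → component (proj₂ (proj₂ c)) (proj₂ (proj₂ returns))
          where
          component : ∀ x {x′} → x′ ≈ ⟦ ε *ᴱ x ⟧ᴱ → s * x′ ≈ s * ⟦ ε ⟧ᴱ * ⟦ x ⟧ᴱ
          component x x′≈ = trans (*-congˡ (trans x′≈ (*ᴱ-homo ε x))) (sym (*-assoc _ _ _))

        cycle : ∀ {s} → Positive s → Path (s * ⟦ ε ⟧ᴱ ⊙ ⟦ c ⟧ᵀ) (suc (length period)) (s ⊙ ⟦ c ⟧ᵀ)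
        cycle {s} 0<s = path-resp (returns-≋ s) (path 0<s around)

        module Cycle = FromCycle {⟦ ε ⟧ᴱ} {⟦ c ⟧ᵀ} 0<ε cycle

      expansion-exists : ∃[ β ] (β 0 ≋ ⟦ start ⟧ᵀ × Steps∞ β)
      expansion-exists = Cycle.iterates S , 1⊙ ⟦ start ⟧ᵀ , Cycle.iterates-steps S
        where
        S : Cycle.State
        S = 1# ⊙ ⟦ start ⟧ᵀ , 1# , 0<1 , length preperiod , path 0<1 to-period

      -- An arbitrary expansion agrees with the known one up to `c` and through one lap, by
      -- uniqueness. After that, the proportionality to its own shift propagates by itself.
      expansion-periodic : ∀ β → β 0 ≋ ⟦ start ⟧ᵀ → Steps∞ β →
        ∃[ l₀ ] ∃[ l ] (∀ i k → l₀ ℕ.≤ k → β (k ℕ.+ suc l) i ≈ ⟦ ε ⟧ᴱ * β k i)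
      expansion-periodic β β₀≋ steps = l₀ , l , λ i k l₀≤k →
        ≡.subst (λ k → β (k ℕ.+ suc l) i ≈ ⟦ ε ⟧ᴱ * β k i) (ℕ.m∸n+n≡m l₀≤k)
          (scaled-forever β steps (suc l) l₀ first-return (k ℕ.∸ l₀) i)
        where
        l₀ = length preperiod
        l  = length period

        β≋c : β l₀ ≋ 1# ⊙ ⟦ c ⟧ᵀ
        β≋c = arrive (path 0<1 to-period) β steps (λ i → trans (β₀≋ i) (sym (1⊙ ⟦ start ⟧ᵀ i)))

        first-return : ∀ i → β (l₀ ℕ.+ suc l) i ≈ ⟦ ε ⟧ᴱ * β l₀ i
        first-return i = trans
          (≡.subst (λ k → β k i ≈ 1# * ⟦ ε ⟧ᴱ * ⟦ c ⟧ᵀ i) (ℕ.+-comm (suc l) l₀)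
            (arrive (cycle 0<1) (λ k → β (k ℕ.+ l₀)) (λ k → steps (k ℕ.+ l₀)) β≋c i))
          (trans (*-congʳ (*-identityˡ _)) (*-congˡ (sym (trans (β≋c i) (1⊙ ⟦ c ⟧ᵀ i)))))

    initial-≋ : ∀ t → ⟦ initial t ⟧ᵀ ≋ vector 1# (value t) (τ * τ)
    initial-≋ t = λ where
      0F → trans (reduce-correct (con 1ℤ)) ι-1
      1F → reduce-correct t
      2F → reduce-correct (var 1F :* var 1F)

    expansion⇒periodic : ∀ t → PeriodicExpansion (initial t) → Periodic τ (vector 1# (value t) (τ * τ))
    expansion⇒periodic t E = record
      { ε = ⟦ ε ⟧ᴱ ; η = ⟦ η ⟧ᴱ
      ; ε-integer = element-integer ε ; η-integer = element-integer η
      ; ε∈ℤ[τ] = element-∈ℤ[τ] ε ; η∈ℤ[τ] = element-∈ℤ[τ] η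
      ; εη≈1 = εη≈1
      ; exists = let β , β₀≋ , steps = expansion-exists E in
          β , (λ i → trans (β₀≋ i) (initial-≋ t i)) , steps
      ; periodic = λ β β₀≋ →
          expansion-periodic E β (λ i → trans (β₀≋ i) (sym (initial-≋ t i)))
      }
      where open PeriodicExpansion E

  open Roots F

  periodic₁ : ∀ n τ → let a = + (3 ℕ.+ n) in
    ι -1ℤ + τ * (ι (ℤ.- a) + τ * (ι (a ℤ.- 1ℤ) + τ * (ι 1ℤ + τ * 0#))) ≈ 0# →
    (Positive τ × Periodic τ (vector 1# τ (τ * τ))) ⊎ (Positive (- τ) × Periodic τ (vector 1# (- τ) (τ * τ)))
  periodic₁ n τ root = Sum.map (Product.map₂ (toPeriodic 𝛕)) (Product.map₂ (toPeriodic (:- 𝛕))) expansion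
    where
    open Root₁ n τ (root₁ n τ root)
    toPeriodic = Cubic.expansion⇒periodic n τ v w cubic

  periodic₂ : ∀ n τ → let a = + (5 ℕ.+ n) in
    ι -1ℤ + τ * (ι (ℤ.- a) + τ * (ι (ℤ.- (a ℤ.- 1ℤ)) + τ * (ι 1ℤ + τ * 0#))) ≈ 0# →
    (Positive τ × Periodic τ (vector 1# τ (τ * τ))) ⊎ (Positive (- τ) × Periodic τ (vector 1# (- τ) (τ * τ)))
  periodic₂ n τ root = Sum.map (Product.map₂ (toPeriodic 𝛕)) (Product.map₂ (toPeriodic (:- 𝛕))) expansion
    where
    open Root₂ n τ (root₂ n τ root)
    toPeriodic = Cubic.expansion⇒periodic n τ v w cubic

open import Defs
open ℚ-Identities using ([x+y]-[z+w]; xy-zw; -x+[x+y]; neg-involutive)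

-- The Cauchy reals as an ordered field

module RealField where

  eventually-≡ : ∀ {x y} N → (∀ n → N ℕ.≤ n → seq x n ≡ seq y n) → x ≈ y
  eventually-≡ {x} {y} N x≡y ε 0<ε = N , λ n n≥ → ≡.subst (ℚ._< ε)
    (≡.cong ∣_∣ (≡.sym (≡.trans (≡.cong (ℚ._- seq y n) (x≡y n n≥)) (ℚ.+-inverseʳ (seq y n))))) 0<ε

  pointwise : ∀ {x y} → (∀ n → seq x n ≡ seq y n) → x ≈ y
  pointwise {x} {y} x≡y = eventually-≡ {x} {y} 0 (λ n _ → x≡y n)

  ≈-sym : ∀ {x y} → x ≈ y → y ≈ x
  ≈-sym {x} {y} x≈y ε 0<ε = let N , h = x≈y ε 0<ε in
    N , λ n n≥ → ≡.subst (ℚ._< ε) (∣p-q∣≡∣q-p∣ (seq x n) (seq y n)) (h n n≥)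

  private
    ⊔ˡ : ∀ {M N n} → M ⊔ N ℕ.≤ n → M ℕ.≤ n
    ⊔ˡ {M} {N} = ℕ.m⊔n≤o⇒m≤o M N

    ⊔ʳ : ∀ {M N n} → M ⊔ N ℕ.≤ n → N ℕ.≤ n
    ⊔ʳ {M} {N} = ℕ.m⊔n≤o⇒n≤o M N

    half+half : ∀ {p q ε} → p ℚ.< ½ ℚ.* ε → q ℚ.< ½ ℚ.* ε → p ℚ.+ q ℚ.< ε
    half+half {ε = ε} p< q< = ℚ.<-≤-trans (ℚ.+-mono-< p< q<) (ℚ.≤-reflexive (½+½ ε))

    +-cancelˡ-< : ∀ p {q r} → p ℚ.+ q ℚ.< p ℚ.+ r → q ℚ.< r
    +-cancelˡ-< p {q} {r} h =
      ≡.subst₂ ℚ._<_ (-x+[x+y] p q) (-x+[x+y] p r) (ℚ.+-monoʳ-< (ℚ.- p) h)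

    p≤∣p-q∣+q : ∀ p q → p ℚ.≤ ∣ p ℚ.- q ∣ ℚ.+ q
    p≤∣p-q∣+q p q = ℚ.≤-trans (ℚ.≤-reflexive (p-q+q p q)) (ℚ.+-monoˡ-≤ q (p≤∣p∣ (p ℚ.- q)))

  ≈-trans : ∀ {x y z} → x ≈ y → y ≈ z → x ≈ z
  ≈-trans {x} {y} {z} x≈y y≈z ε 0<ε =
    let M , h = x≈y (½ ℚ.* ε) (half-pos 0<ε)
        N , k = y≈z (½ ℚ.* ε) (half-pos 0<ε)
    in M ⊔ N , λ n n≥ → ℚ.≤-<-trans (triangle (seq x n) (seq y n) (seq z n))
                          (half+half (h n (⊔ˡ n≥)) (k n (⊔ʳ {M} n≥)))
    where
    triangle : ∀ p q r → ∣ p ℚ.- r ∣ ℚ.≤ ∣ p ℚ.- q ∣ ℚ.+ ∣ q ℚ.- r ∣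
    triangle p q r = ℚ.≤-trans (ℚ.≤-reflexive (≡.cong ∣_∣ (≡.trans
      (≡.cong (ℚ._- r) (p-q+q p q)) (ℚ.+-assoc (p ℚ.- q) q (ℚ.- r)))))
      (ℚ.∣p+q∣≤∣p∣+∣q∣ (p ℚ.- q) (q ℚ.- r))

  +-cong : ∀ {x y u v} → x ≈ y → u ≈ v → x + u ≈ y + v
  +-cong {x} {y} {u} {v} x≈y u≈v ε 0<ε =
    let M , h = x≈y (½ ℚ.* ε) (half-pos 0<ε)
        N , k = u≈v (½ ℚ.* ε) (half-pos 0<ε)
    in M ⊔ N , λ n n≥ → ℚ.≤-<-trans
         (ℚ.≤-trans (ℚ.≤-reflexive (≡.cong ∣_∣ ([x+y]-[z+w] (seq x n) (seq u n) (seq y n) (seq v n))))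
           (ℚ.∣p+q∣≤∣p∣+∣q∣ (seq x n ℚ.- seq y n) (seq u n ℚ.- seq v n)))
         (half+half (h n (⊔ˡ n≥)) (k n (⊔ʳ {M} n≥)))

  -‿cong : ∀ {x y} → x ≈ y → - x ≈ - y
  -‿cong {x} {y} x≈y ε 0<ε = let N , h = x≈y ε 0<ε in
    N , λ n n≥ → ≡.subst (ℚ._< ε) (eq (seq x n) (seq y n)) (h n n≥)
    where
    eq : ∀ p q → ∣ p ℚ.- q ∣ ≡ ∣ ℚ.- p ℚ.- ℚ.- q ∣
    eq p q = ≡.trans (≡.sym (ℚ.∣-p∣≡∣p∣ (p ℚ.- q))) (≡.cong ∣_∣ (ℚ.neg-distrib-+ p (ℚ.- q)))

  *-cong : ∀ {x y u v} → x ≈ y → u ≈ v → x * u ≈ y * v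
  *-cong {x} {y} {u} {v} x≈y u≈v ε 0<ε =
    let B , 0<B , K , bx = bounded x
        C , 0<C , L , bv = bounded v
        B′ , 0<B′ , BB′ = recip-pos 0<B
        C′ , 0<C′ , CC′ = recip-pos 0<C
        M , hu = u≈v (B′ ℚ.* (½ ℚ.* ε)) (*-pos 0<B′ (half-pos 0<ε))
        N , hx = x≈y (C′ ℚ.* (½ ℚ.* ε)) (*-pos 0<C′ (half-pos 0<ε))
    in (K ⊔ L) ⊔ (M ⊔ N) , λ n n≥ →
      let xn = seq x n ; yn = seq y n ; un = seq u n ; vn = seq v n
          n≥KL = ⊔ˡ {K ⊔ L} n≥ ; n≥MN = ⊔ʳ {K ⊔ L} n≥
      in begin-strict
      ∣ xn ℚ.* un ℚ.- yn ℚ.* vn ∣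
        ≡⟨ ≡.cong ∣_∣ (xy-zw xn un yn vn) ⟩
      ∣ xn ℚ.* (un ℚ.- vn) ℚ.+ vn ℚ.* (xn ℚ.- yn) ∣
        ≤⟨ ℚ.∣p+q∣≤∣p∣+∣q∣ (xn ℚ.* (un ℚ.- vn)) (vn ℚ.* (xn ℚ.- yn)) ⟩
      ∣ xn ℚ.* (un ℚ.- vn) ∣ ℚ.+ ∣ vn ℚ.* (xn ℚ.- yn) ∣
        <⟨ half+half (bound xn (un ℚ.- vn) 0<B (bx n (⊔ˡ n≥KL)) (hu n (⊔ˡ n≥MN)) BB′)
                     (bound vn (xn ℚ.- yn) 0<C (bv n (⊔ʳ {K} n≥KL)) (hx n (⊔ʳ {M} n≥MN)) CC′) ⟩
      ε ∎
    where
    open ℚ.≤-Reasoning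
    bound : ∀ p q {B B′ δ} → 0ℚ ℚ.< B → ∣ p ∣ ℚ.≤ B → ∣ q ∣ ℚ.< B′ ℚ.* δ → B ℚ.* B′ ≡ 1ℚ →
            ∣ p ℚ.* q ∣ ℚ.< δ
    bound p q {B} {B′} {δ} 0<B p≤B q< BB′ = begin-strict
      ∣ p ℚ.* q ∣          ≡⟨ ℚ.∣p*q∣≡∣p∣*∣q∣ p q ⟩
      ∣ p ∣ ℚ.* ∣ q ∣      ≤⟨ ℚ.*-monoʳ-≤-nonNeg ∣ q ∣ {{ℚ.nonNegative (ℚ.0≤∣p∣ q)}} p≤B ⟩
      B ℚ.* ∣ q ∣          <⟨ ℚ.*-monoʳ-<-pos B {{ℚ.positive 0<B}} q< ⟩
      B ℚ.* (B′ ℚ.* δ)     ≡⟨ scale B B′ δ BB′ ⟩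
      δ                    ∎

  +-*-commutativeRing : CommutativeRing 0ℓ 0ℓ
  +-*-commutativeRing = record
    { Carrier = ℝ ; _≈_ = _≈_ ; _+_ = _+_ ; _*_ = _*_ ; -_ = -_ ; 0# = 0ℝ ; 1# = 1ℝ
    ; isCommutativeRing = record
      { isRing = record
        { +-isAbelianGroup = record
          { isGroup = record
            { isMonoid = record
              { isSemigroup = record
                { isMagma = record
                  { isEquivalence = record
                    { refl  = λ {x} → pointwise {x} {x} (λ _ → ≡.refl)
                    ; sym   = λ {x} {y} → ≈-sym {x} {y}
                    ; trans = λ {x} {y} {z} → ≈-trans {x} {y} {z} }
                  ; ∙-cong = λ {x} {y} {u} {v} → +-cong {x} {y} {u} {v} }
                ; assoc = λ x y z → pointwise {x + y + z} {x + (y + z)} λ n → ℚ.+-assoc (seq x n) (seq y n) (seq z n) }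
              ; identity = (λ x → pointwise {0ℝ + x} {x} λ n → ℚ.+-identityˡ (seq x n))
                         , (λ x → pointwise {x + 0ℝ} {x} λ n → ℚ.+-identityʳ (seq x n)) }
            ; inverse = (λ x → pointwise { - x + x} {0ℝ} λ n → ℚ.+-inverseˡ (seq x n))
                      , (λ x → pointwise {x - x} {0ℝ} λ n → ℚ.+-inverseʳ (seq x n))
            ; ⁻¹-cong = λ {x} {y} → -‿cong {x} {y} }
          ; comm = λ x y → pointwise {x + y} {y + x} λ n → ℚ.+-comm (seq x n) (seq y n) }
        ; *-cong = λ {x} {y} {u} {v} → *-cong {x} {y} {u} {v}
        ; *-assoc = λ x y z → pointwise {x * y * z} {x * (y * z)} λ n → ℚ.*-assoc (seq x n) (seq y n) (seq z n)
        ; *-identity = (λ x → pointwise {1ℝ * x} {x} λ n → ℚ.*-identityˡ (seq x n))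
                     , (λ x → pointwise {x * 1ℝ} {x} λ n → ℚ.*-identityʳ (seq x n))
        ; distrib = (λ x y z → pointwise {x * (y + z)} {x * y + x * z} λ n → ℚ.*-distribˡ-+ (seq x n) (seq y n) (seq z n))
                  , (λ x y z → pointwise {(y + z) * x} {y * x + z * x} λ n → ℚ.*-distribʳ-+ (seq x n) (seq y n) (seq z n)) }
      ; *-comm = λ x y → pointwise {x * y} {y * x} λ n → ℚ.*-comm (seq x n) (seq y n) } }

  private
    toℚᵘ-/1 : ∀ i → ℚ.toℚᵘ (i ℚ./ 1) ℚᵘ.≃ mkℚᵘ i 0
    toℚᵘ-/1 i = ℚ.toℚᵘ-fromℚᵘ (mkℚᵘ i 0)

  /1-+ : ∀ i j → (i ℤ.+ j) ℚ./ 1 ≡ i ℚ./ 1 ℚ.+ j ℚ./ 1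
  /1-+ i j = ℚ.toℚᵘ-injective (begin
    ℚ.toℚᵘ ((i ℤ.+ j) ℚ./ 1)                  ≈⟨ toℚᵘ-/1 (i ℤ.+ j) ⟩
    -- Unnormalised addition computes the numerator `i * 1 + j * 1`, so only the factors 1 have to
    -- be removed.
    mkℚᵘ (i ℤ.+ j) 0                          ≈⟨ ℚᵘ.≃-reflexive (≡.cong₂ (λ k l → mkℚᵘ (k ℤ.+ l) 0)
                                                   (ℤ.*-identityʳ i) (ℤ.*-identityʳ j)) ⟨
    mkℚᵘ i 0 ℚᵘ.+ mkℚᵘ j 0                    ≈⟨ ℚᵘ.+-cong (toℚᵘ-/1 i) (toℚᵘ-/1 j) ⟨
    ℚ.toℚᵘ (i ℚ./ 1) ℚᵘ.+ ℚ.toℚᵘ (j ℚ./ 1)    ≈⟨ ℚ.toℚᵘ-homo-+ (i ℚ./ 1) (j ℚ./ 1) ⟨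
    ℚ.toℚᵘ (i ℚ./ 1 ℚ.+ j ℚ./ 1)              ∎)
    where open import Relation.Binary.Reasoning.Setoid ℚᵘ.≃-setoid

  /1-* : ∀ i j → (i ℤ.* j) ℚ./ 1 ≡ i ℚ./ 1 ℚ.* (j ℚ./ 1)
  /1-* i j = ℚ.toℚᵘ-injective (begin
    ℚ.toℚᵘ ((i ℤ.* j) ℚ./ 1)                  ≈⟨ toℚᵘ-/1 (i ℤ.* j) ⟩
    mkℚᵘ i 0 ℚᵘ.* mkℚᵘ j 0                    ≈⟨ ℚᵘ.*-cong (toℚᵘ-/1 i) (toℚᵘ-/1 j) ⟨
    ℚ.toℚᵘ (i ℚ./ 1) ℚᵘ.* ℚ.toℚᵘ (j ℚ./ 1)    ≈⟨ ℚ.toℚᵘ-homo-* (i ℚ./ 1) (j ℚ./ 1) ⟨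
    ℚ.toℚᵘ (i ℚ./ 1 ℚ.* (j ℚ./ 1))            ∎)
    where open import Relation.Binary.Reasoning.Setoid ℚᵘ.≃-setoid

  /1-neg : ∀ i → (ℤ.- i) ℚ./ 1 ≡ ℚ.- (i ℚ./ 1)
  /1-neg (+ zero)    = ≡.refl
  /1-neg (+ suc n)   = ≡.refl
  /1-neg ℤ.-[1+ n ]  = ≡.sym (neg-involutive (+ suc n ℚ./ 1))

  private
    mk-positive : ∀ {x ε} N → 0ℚ ℚ.< ε → (∀ n → N ℕ.≤ n → ε ℚ.< seq x n) → 0ℝ < x
    mk-positive {x} {ε} N 0<ε h =
      ε , 0<ε , N , λ n n≥ → ≡.subst (ℚ._< seq x n) (≡.sym (ℚ.+-identityˡ ε)) (h n n≥)

    un-positive : ∀ {x} → 0ℝ < x → ∃[ ε ] (0ℚ ℚ.< ε × ∃[ N ] ∀ n → N ℕ.≤ n → ε ℚ.< seq x n)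
    un-positive {x} (ε , 0<ε , N , h) =
      ε , 0<ε , N , λ n n≥ → ≡.subst (ℚ._< seq x n) (ℚ.+-identityˡ ε) (h n n≥)

    -- One term beyond the Cauchy modulus decides: all later terms are within `δ` of it, hence
    -- exceed `δ`.
    sign-from-term : ∀ {x δ} N → 0ℚ ℚ.< δ →
      (∀ m n → N ℕ.≤ m → N ℕ.≤ n → ∣ seq x m ℚ.- seq x n ∣ ℚ.< δ) → δ ℚ.+ δ ℚ.< seq x N → 0ℝ < x
    sign-from-term {x} {δ} N 0<δ h 2δ< = mk-positive {x} N 0<δ λ n n≥ →
      +-cancelˡ-< δ (ℚ.<-trans 2δ<
        (ℚ.≤-<-trans (p≤∣p-q∣+q (seq x N) (seq x n)) (ℚ.+-monoˡ-< (seq x n) (h N n ℕ.≤-refl n≥))))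

  pos-resp : ∀ {x y} → x ≈ y → 0ℝ < x → 0ℝ < y
  pos-resp {x} {y} x≈y 0<x =
    let ε , 0<ε , M , h = un-positive {x} 0<x
        N , k = x≈y (½ ℚ.* ε) (half-pos 0<ε)
    in mk-positive {y} (M ⊔ N) (half-pos 0<ε) λ n n≥ → +-cancelˡ-< (½ ℚ.* ε) (begin-strict
         ½ ℚ.* ε ℚ.+ ½ ℚ.* ε                          ≡⟨ ½+½ ε ⟩
         ε                                            <⟨ h n (⊔ˡ n≥) ⟩
         seq x n                                      ≤⟨ p≤∣p-q∣+q (seq x n) (seq y n) ⟩
         ∣ seq x n ℚ.- seq y n ∣ ℚ.+ seq y n          <⟨ ℚ.+-monoˡ-< (seq y n) (k n (⊔ʳ {M} n≥)) ⟩
         ½ ℚ.* ε ℚ.+ seq y n                          ∎)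
    where open ℚ.≤-Reasoning

  pos-+ : ∀ {x y} → 0ℝ < x → 0ℝ < y → 0ℝ < x + y
  pos-+ {x} {y} 0<x 0<y =
    let ε , 0<ε , M , h = un-positive {x} 0<x
        δ , 0<δ , N , k = un-positive {y} 0<y
    in mk-positive {x + y} (M ⊔ N) (ℚ.+-mono-< 0<ε 0<δ) λ n n≥ → ℚ.+-mono-< (h n (⊔ˡ n≥)) (k n (⊔ʳ {M} n≥))

  pos-* : ∀ {x y} → 0ℝ < x → 0ℝ < y → 0ℝ < x * y
  pos-* {x} {y} 0<x 0<y =
    let ε , 0<ε , M , h = un-positive {x} 0<x
        δ , 0<δ , N , k = un-positive {y} 0<y
    in mk-positive {x * y} (M ⊔ N) (*-pos 0<ε 0<δ) λ n n≥ → ℚ.<-trans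
         (ℚ.*-monoʳ-<-pos ε {{ℚ.positive 0<ε}} (k n (⊔ʳ {M} n≥)))
         (ℚ.*-monoˡ-<-pos (seq y n) {{ℚ.positive (ℚ.<-trans 0<δ (k n (⊔ʳ {M} n≥)))}} (h n (⊔ˡ n≥)))

  pos-fromℤ : ∀ n → 0ℝ < fromℤ (+ suc n)
  pos-fromℤ n = mk-positive {fromℤ (+ suc n)} 0 (half-pos 0<q) λ _ _ → begin-strict
    ½ ℚ.* q               ≡⟨ ℚ.+-identityˡ _ ⟨
    0ℚ ℚ.+ ½ ℚ.* q        <⟨ ℚ.+-monoˡ-< (½ ℚ.* q) (half-pos 0<q) ⟩
    ½ ℚ.* q ℚ.+ ½ ℚ.* q   ≡⟨ ½+½ q ⟩
    q                     ∎
    where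
    open ℚ.≤-Reasoning
    q = + suc n ℚ./ 1
    0<q : 0ℚ ℚ.< q
    0<q = ℚ.positive⁻¹ q {{ℚ.normalize-pos (suc n) 1}}

  ¬pos-0 : ¬ 0ℝ < 0ℝ
  ¬pos-0 (ε , 0<ε , N , h) =
    ℚ.<-asym 0<ε (≡.subst (ℚ._< 0ℚ) (ℚ.+-identityˡ ε) (h N ℕ.≤-refl))

  -- At a late index the two terms sum to more than `ε`, so one of them exceeds `½ ε`. Comparing
  -- rationals is decidable, and Cauchy modulus `¼ ε` carries the outcome over to the real number.
  pos-split : ∀ {x y} → 0ℝ < x + y → 0ℝ < x ⊎ 0ℝ < y
  pos-split {x} {y} 0<x+y
    with ε , 0<ε , K , h ← un-positive {x + y} 0<x+y
    with 0<δ ← half-pos (half-pos 0<ε)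
    with M , hx ← cauchy x (½ ℚ.* (½ ℚ.* ε)) 0<δ
       | N , hy ← cauchy y (½ ℚ.* (½ ℚ.* ε)) 0<δ
    with I ← K ⊔ (M ⊔ N) in I≡
    with K≤I ← ⊔ˡ {K} (ℕ.≤-reflexive I≡)
       | M≤I ← ⊔ˡ {M} (⊔ʳ {K} (ℕ.≤-reflexive I≡))
       | N≤I ← ⊔ʳ {M} (⊔ʳ {K} (ℕ.≤-reflexive I≡))
    with ½ ℚ.* ε ℚ.<? seq x I
  ... | yes ½ε<x = inj₁ (sign-from-term {x} I 0<δ
          (λ m n m≥ n≥ → hx m n (ℕ.≤-trans M≤I m≥) (ℕ.≤-trans M≤I n≥))
          (ℚ.≤-<-trans (ℚ.≤-reflexive (½+½ (½ ℚ.* ε))) ½ε<x))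
  ... | no  ½ε≮x = inj₂ (sign-from-term {y} I 0<δ
          (λ m n m≥ n≥ → hy m n (ℕ.≤-trans N≤I m≥) (ℕ.≤-trans N≤I n≥))
          (ℚ.≤-<-trans (ℚ.≤-reflexive (½+½ (½ ℚ.* ε))) (+-cancelˡ-< (½ ℚ.* ε)
            (ℚ.<-≤-trans (ℚ.≤-<-trans (ℚ.≤-reflexive (½+½ ε)) (h I K≤I))
              (ℚ.+-monoˡ-≤ (seq y I) (ℚ.≮⇒≥ ½ε≮x))))))

  -- With `B` bounding the terms of `y`, a late term of `x` has absolute value above `ε / B`. Such a
  -- term has a decidable sign, and it is far enough from 0 for later terms to keep that sign.
  pos-factor : ∀ {x y} → 0ℝ < x * y → 0ℝ < x ⊎ 0ℝ < - x
  pos-factor {x} {y} 0<xy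
    with ε , 0<ε , K , h ← un-positive {x * y} 0<xy
    with B , 0<B , L , by ← bounded y
    with C , 0<C , BC ← recip-pos 0<B
    with 0<δ ← half-pos (*-pos 0<C 0<ε)
    with M , hx ← cauchy x (½ ℚ.* (C ℚ.* ε)) 0<δ | N , hx′ ← cauchy (- x) (½ ℚ.* (C ℚ.* ε)) 0<δ
    with I ← (K ⊔ L) ⊔ (M ⊔ N) in I≡
    with K≤I ← ⊔ˡ {K} (⊔ˡ {K ⊔ L} (ℕ.≤-reflexive I≡))
       | L≤I ← ⊔ʳ {K} (⊔ˡ {K ⊔ L} (ℕ.≤-reflexive I≡))
       | M≤I ← ⊔ˡ {M} (⊔ʳ {K ⊔ L} (ℕ.≤-reflexive I≡))
       | N≤I ← ⊔ʳ {M} (⊔ʳ {K ⊔ L} (ℕ.≤-reflexive I≡))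
    = Sum.map
        (λ ∣x∣≡x → sign-from-term {x} I 0<δ
          (λ m n m≥ n≥ → hx m n (ℕ.≤-trans M≤I m≥) (ℕ.≤-trans M≤I n≥))
          (≡.subst (_ ℚ.<_) ∣x∣≡x large))
        (λ ∣x∣≡-x → sign-from-term { - x} I 0<δ
          (λ m n m≥ n≥ → hx′ m n (ℕ.≤-trans N≤I m≥) (ℕ.≤-trans N≤I n≥))
          (≡.subst (_ ℚ.<_) ∣x∣≡-x large))
        (ℚ.∣p∣≡p∨∣p∣≡-p (seq x I))
    where
    open ℚ.≤-Reasoning
    large : ½ ℚ.* (C ℚ.* ε) ℚ.+ ½ ℚ.* (C ℚ.* ε) ℚ.< ∣ seq x I ∣
    large = ℚ.≤-<-trans (ℚ.≤-reflexive (½+½ (C ℚ.* ε)))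
      (ℚ.*-cancelˡ-<-nonNeg B {{ℚ.nonNegative (ℚ.<⇒≤ 0<B)}} (begin-strict
      B ℚ.* (C ℚ.* ε)                   ≡⟨ scale B C ε BC ⟩
      ε                                 <⟨ h I K≤I ⟩
      seq x I ℚ.* seq y I               ≤⟨ p≤∣p∣ _ ⟩
      ∣ seq x I ℚ.* seq y I ∣           ≡⟨ ℚ.∣p*q∣≡∣p∣*∣q∣ (seq x I) (seq y I) ⟩
      ∣ seq x I ∣ ℚ.* ∣ seq y I ∣       ≤⟨ ℚ.*-monoˡ-≤-nonNeg ∣ seq x I ∣ {{ℚ.nonNegative (ℚ.0≤∣p∣ (seq x I))}} (by I L≤I) ⟩
      ∣ seq x I ∣ ℚ.* B                 ≡⟨ ℚ.*-comm ∣ seq x I ∣ B ⟩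
      B ℚ.* ∣ seq x I ∣                 ∎))

  *-inverseʳ : ∀ x (x#0 : x # 0ℝ) → x * inv x x#0 ≈ 1ℝ
  *-inverseʳ x x#0 = let δ , 0<δ , N , h = bounded-away x x#0 in
    eventually-≡ {x * inv x x#0} {1ℝ} N λ n n≥ →
      recip-inverse (seq x n) (λ x≡0 → ℚ.<-asym 0<δ (≡.subst (λ p → δ ℚ.< ∣ p ∣) x≡0 (h n n≥)))

  abs-positive : ∀ {x} → 0ℝ < x → abs x ≈ x
  abs-positive {x} 0<x = let ε , 0<ε , N , h = un-positive {x} 0<x in
    eventually-≡ {abs x} {x} N λ n n≥ → ℚ.0≤p⇒∣p∣≡p (ℚ.<⇒≤ (ℚ.<-trans 0<ε (h n n≥)))

  abs-negative : ∀ {x} → 0ℝ < - x → abs x ≈ - x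
  abs-negative {x} 0<-x = let ε , 0<ε , N , h = un-positive { - x} 0<-x in
    eventually-≡ {abs x} { - x} N λ n n≥ →
      ≡.trans (≡.sym (ℚ.∣-p∣≡∣p∣ (seq x n))) (ℚ.0≤p⇒∣p∣≡p (ℚ.<⇒≤ (ℚ.<-trans 0<ε (h n n≥))))

  ℝ-orderedField : OrderedField
  ℝ-orderedField = record
    { commutativeRing = +-*-commutativeRing
    ; ι          = fromℤ
    ; ι-+        = λ i j → pointwise {fromℤ (i ℤ.+ j)} {fromℤ i + fromℤ j} λ _ → /1-+ i j
    ; ι-*        = λ i j → pointwise {fromℤ (i ℤ.* j)} {fromℤ i * fromℤ j} λ _ → /1-* i j
    ; ι-neg      = λ i → pointwise {fromℤ (ℤ.- i)} { - fromℤ i} λ _ → /1-neg i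
    ; ι-0        = pointwise {fromℤ 0ℤ} {0ℝ} λ _ → ≡.refl
    ; ι-1        = pointwise {fromℤ 1ℤ} {1ℝ} λ _ → ≡.refl
    ; Positive   = 0ℝ <_
    ; pos-resp   = λ {x} {y} → pos-resp {x} {y}
    ; pos-+      = λ {x} {y} → pos-+ {x} {y}
    ; pos-*      = λ {x} {y} → pos-* {x} {y}
    ; pos-ι      = pos-fromℤ
    ; ¬pos-0     = ¬pos-0
    ; pos-split  = λ {x} {y} → pos-split {x} {y}
    ; pos-factor = λ {x} {y} → pos-factor {x} {y}
    ; inverse    = λ {x} 0<x → inv x (inj₂ 0<x) , *-inverseʳ x (inj₂ 0<x)
    }

  module R = OrderedFieldProperties ℝ-orderedField

  <⇒pos : ∀ {x y} → x < y → R.Positive (y R.- x)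
  <⇒pos {x} {y} (ε , 0<ε , N , h) = mk-positive {y R.- x} N 0<ε λ n n≥ → begin-strict
    ε                                   ≡⟨ -x+[x+y] (seq x n) ε ⟨
    ℚ.- seq x n ℚ.+ (seq x n ℚ.+ ε)     <⟨ ℚ.+-monoʳ-< (ℚ.- seq x n) (h n n≥) ⟩
    ℚ.- seq x n ℚ.+ seq y n             ≡⟨ ℚ.+-comm (ℚ.- seq x n) (seq y n) ⟩
    seq y n ℚ.- seq x n                 ∎
    where open ℚ.≤-Reasoning

  pos⇒< : ∀ {x y} → R.Positive (y R.- x) → x < y
  pos⇒< {x} {y} 0<y-x = let ε , 0<ε , N , h = un-positive {y R.- x} 0<y-x in
    ε , 0<ε , N , λ n n≥ → begin-strict
    seq x n ℚ.+ ε                       ≡⟨ ℚ.+-comm (seq x n) ε ⟩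
    ε ℚ.+ seq x n                       <⟨ ℚ.+-monoˡ-< (seq x n) (h n n≥) ⟩
    (seq y n ℚ.- seq x n) ℚ.+ seq x n   ≡⟨ p-q+q (seq y n) (seq x n) ⟨
    seq y n                             ∎
    where open ℚ.≤-Reasoning

  negation-positive⇒<0 : ∀ {x} → R.Positive (R.- x) → x < 0ℝ
  negation-positive⇒<0 {x} 0<-x = let ε , 0<ε , N , h = un-positive {R.- x} 0<-x in
    ε , 0<ε , N , λ n n≥ → ≡.subst (seq x n ℚ.+ ε ℚ.<_) (ℚ.+-inverseʳ (seq x n)) (ℚ.+-monoʳ-< (seq x n) (h n n≥))

-- Translation to the stated definitions

open RealField

private
  module J = JacobiPerron ℝ-orderedField

floor⇒isFloor : ∀ {x b} → R.Floor x b → IsFloor x b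
floor⇒isFloor {x} {b} (b≤x , x<b+1) =
  (λ x<b → b≤x (<⇒pos {x} {fromℤ b} x<b)) , pos⇒< {x} {fromℤ (b ℤ.+ 1ℤ)} x<b+1

isFloor⇒floor : ∀ {x b} → IsFloor x b → R.Floor x b
isFloor⇒floor {x} {b} (b≤x , x<b+1) =
  (λ p → b≤x (pos⇒< {x} {fromℤ b} p)) , <⇒pos {x} {fromℤ (b ℤ.+ 1ℤ)} x<b+1

sign⇒#0 : ∀ {x} → R.Positive x ⊎ R.Positive (R.- x) → x # 0ℝ
sign⇒#0 (inj₁ 0<x)     = inj₂ 0<x
sign⇒#0 {x} (inj₂ x<0) = inj₁ (negation-positive⇒<0 {x} x<0)

invertible⇒#0 : ∀ {x y} → x * y ≈ 1ℝ → x # 0ℝ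
invertible⇒#0 {x} {y} xy≈1 = sign⇒#0 {x} (R.invertible-sign {x} {y} xy≈1)

jpaStep⇒step : ∀ {β β′} → JPAStep β β′ → J.Step β β′
jpaStep⇒step {β} {β′} (β₁#0 , b , c , floor-b , floor-c , next) =
  J.mkStep {β} {β′} {inv (β 0F) β₁#0} b c (*-inverseʳ (β 0F) β₁#0)
    (isFloor⇒floor {β 1F / β 0F [ β₁#0 ]} {b} floor-b) (isFloor⇒floor {β 2F / β 0F [ β₁#0 ]} {c} floor-c)
    (next 0F) (next 1F) (next 2F)

step⇒jpaStep : ∀ {β β′} → J.Step β β′ → JPAStep β β′
step⇒jpaStep {β} {β′} (J.mkStep {i} b c β₁i≈1 floor-b floor-c n₀ n₁ n₂) =
  β₁#0 , b , c
    , floor⇒isFloor {β 1F / β 0F [ β₁#0 ]} {b}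
        (R.floor-resp {β 1F * i} {β 1F * j} {b} (same-quotient (β 1F)) floor-b)
    , floor⇒isFloor {β 2F / β 0F [ β₁#0 ]} {c}
        (R.floor-resp {β 2F * i} {β 2F * j} {c} (same-quotient (β 2F)) floor-c)
    , λ where
        0F → n₀
        1F → n₁
        2F → n₂
  where
  β₁#0 : β 0F # 0ℝ
  β₁#0 = invertible⇒#0 {β 0F} {i} β₁i≈1

  j = inv (β 0F) β₁#0

  -- A `Step` carries some inverse of `β 0F`, whereas `JPAStep` divides by `inv`; scaling by 1 shows
  -- that the quotients agree.
  same-quotient : ∀ y → y * i ≈ y * j
  same-quotient y = R.quotient-scaled {1ℝ} {β 0F} {y} {β 0F} {y} {i} {j}
    (one (β 0F)) (one y) β₁i≈1 (*-inverseʳ (β 0F) β₁#0)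
    where
    one : ∀ x → x ≈ 1ℝ * x
    one x = ≈-sym {1ℝ * x} {x} (R.*-identityˡ x)

ℤ[τ]⊆ℚ⟨τ⟩ : ∀ {τ x} → R.ℤ[ τ ] x → ℚ⟨ τ ⟩ x
ℤ[τ]⊆ℚ⟨τ⟩ R.gen                  = gen
ℤ[τ]⊆ℚ⟨τ⟩ (R.int i)              = rat (i ℚ./ 1)
ℤ[τ]⊆ℚ⟨τ⟩ (R.add {x} {y} p q)    = add {x = x} {y} (ℤ[τ]⊆ℚ⟨τ⟩ p) (ℤ[τ]⊆ℚ⟨τ⟩ q)
ℤ[τ]⊆ℚ⟨τ⟩ (R.mul {x} {y} p q)    = mul {x = x} {y} (ℤ[τ]⊆ℚ⟨τ⟩ p) (ℤ[τ]⊆ℚ⟨τ⟩ q)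
ℤ[τ]⊆ℚ⟨τ⟩ (R.resp {x} {y} x≈y p) = resp {x = x} {y} x≈y (ℤ[τ]⊆ℚ⟨τ⟩ p)

periodicJPA : ∀ {τ t} → abs τ ≈ t → J.Periodic τ (J.vector R.1# t (τ R.* τ)) →
              HasPeriodicJPA τ (vec 1ℝ (abs τ) (τ * τ))
periodicJPA {τ} {t} ∣τ∣≈t P =
    (let β , β₀≋ , steps = exists in
      β , (λ i → ≈-trans {β 0 i} {J.vector R.1# t (τ R.* τ) i} {vec 1ℝ (abs τ) (τ * τ) i} (β₀≋ i) (start≋ i))
        , λ k → step⇒jpaStep (steps k))
  , λ β (β₀≈ , steps) →
      let l₀ , l , returns = periodic β
            (λ i → ≈-trans {β 0 i} {vec 1ℝ (abs τ) (τ * τ) i} {J.vector R.1# t (τ R.* τ) i} (β₀≈ i)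
              (≈-sym {J.vector R.1# t (τ R.* τ) i} {vec 1ℝ (abs τ) (τ * τ) i} (start≋ i)))
            (λ k → jpaStep⇒step (steps k))
      in l₀ , suc l , ε , s≤s z≤n
         , ((ℤ[τ]⊆ℚ⟨τ⟩ ε∈ℤ[τ] , integer ε-integer) , η , (ℤ[τ]⊆ℚ⟨τ⟩ η∈ℤ[τ] , integer η-integer) , εη≈1)
         , returns
  where
  open J.Periodic P

  integer : ∀ {ξ} → R.CubicInteger ξ → AlgebraicInteger ξ
  integer (k₀ , k₁ , k₂ , root) = k₀ ∷ k₁ ∷ k₂ ∷ [] , root

  start≋ : ∀ i → J.vector R.1# t (τ R.* τ) i ≈ vec 1ℝ (abs τ) (τ * τ) i
  start≋ 0F = R.refl {1ℝ}
  start≋ 1F = ≈-sym {abs τ} {t} ∣τ∣≈t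
  start≋ 2F = R.refl {τ * τ}

periodicJPA-by-sign : ∀ {τ} →
  (R.Positive τ × J.Periodic τ (J.vector R.1# τ (τ R.* τ))) ⊎
  (R.Positive (R.- τ) × J.Periodic τ (J.vector R.1# (R.- τ) (τ R.* τ))) →
  HasPeriodicJPA τ (vec 1ℝ (abs τ) (τ * τ))
periodicJPA-by-sign {τ} (inj₁ (0<τ , P)) = periodicJPA (abs-positive {τ} 0<τ) P
periodicJPA-by-sign {τ} (inj₂ (τ<0 , P)) = periodicJPA (abs-negative {τ} τ<0) P

theorem1p3 : (a : ℤ) (τ : ℝ) →
    -- x³ + (a - 1) x² - a x - 1
    ( (a ≥ℤ + 3 × IsRoot (-1ℤ ∷ -ℤ a ∷ (a -ℤ 1ℤ) ∷ 1ℤ ∷ []) τ)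
    -- x³ - (a - 1) x² - a x - 1
    ⊎ (a ≥ℤ + 5 × IsRoot (-1ℤ ∷ -ℤ a ∷ -ℤ (a -ℤ 1ℤ) ∷ 1ℤ ∷ []) τ) ) →
    HasPeriodicJPA τ (vec 1ℝ (abs τ) (τ * τ))
-- Matching on the inequality replaces `a` by `+ (3 ℕ.+ n)`, after which the root hypothesis unfolds
-- to the Horner expression that `periodic₁` expects.
theorem1p3 _ τ (inj₁ (+≤+ (s≤s (s≤s (s≤s (z≤n {n})))) , root)) =
  periodicJPA-by-sign (J.periodic₁ n τ root)
theorem1p3 _ τ (inj₂ (+≤+ (s≤s (s≤s (s≤s (s≤s (s≤s (z≤n {n})))))) , root)) =
  periodicJPA-by-sign (J.periodic₂ n τ root)
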